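{- For every graph $H$, ${\delta_{\text{poly-rem}}}(H)\leq \delta_{\text{hom}}(\mathcal{I}_H)$.
   Context: All graphs are finite and simple; "copies" of $H$ in $G$ are labeled copies (injective maps $V(H)\to V(G)$ sending edges to edges). For a graph $H$, $\varepsilon>0$ and $\gamma\in[0,1]$, let $\delta(\varepsilon,H;\gamma)$ be the maximum $\delta\in[0,1]$ such that every $n$-vertex graph $G$ with minimum degree at least $\gamma n$ which contains $\varepsilon n^2$ edge-disjoint copies of $H$ contains at least $\delta n^{v(H)}$ copies of $H$. The polynomial removal threshold ${\delta_{\text{poly-rem}}}(H)$ is the infimum of those $\gamma$ for which there exists $\mu=\mu(\gamma)>0$ with $\delta(\varepsilon,H;\gamma)\geq\mu\varepsilon^{1/\mu}$ for all $\varepsilon>0$. A graph is $\mathcal{H}$-free for a family $\mathcal{H}$ of graphs if it contains no member of $\mathcal{H}$ as a subgraph. The homomorphism threshold $\delta_{\text{hom}}(\mathcal{H})$ of a family $\mathcal{H}$ is the infimum of those $\gamma$ for which there exists an $\mathcal{H}$-free graph $F=F(\gamma)$ such that every $n$-vertex $\mathcal{H}$-free graph $G$ with minimum degree at least $\gamma n$ admits a graph homomorphism to $F$. $\mathcal{I}_H$ denotes the set of all graphs $H'$ that are minimal with respect to inclusion (subgraph relation) among graphs to which $H$ admits a homomorphism.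
   Formalization: In the definition of the polynomial removal threshold, ε ranges over (0,1] instead of all ε>0, since for large ε the bound με^{1/μ} exceeds 1 and no γ could satisfy it; thresholds γ and ε are taken rational, which gives the same infima. -}

module Defs where

open import Data.Bool using (Bool; true; false; if_then_else_)
open import Data.Nat as ℕ using (ℕ; zero; suc)
open import Data.Fin using (Fin)
open import Data.List using (List; length; map; allFin)
open import Data.Nat.ListAction using (sum)
open import Data.List.Relation.Unary.AllPairs using (AllPairs)
open import Data.Integer using (+_)
open import Data.Rational using (ℚ; _/_; _*_; _≤_; _<_; 0ℚ; 1ℚ)
open import Data.Product using (Σ; ∃; ∃-syntax; _×_; proj₁)
open import Function.Definitions using (Injective)
open import Relation.Binary.PropositionalEquality using (_≡_)
open import Relation.Nullary using (¬_)

record Graph (n : ℕ) : Set where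
  field
    adj : Fin n → Fin n → Bool
    adj-sym : ∀ x y → adj x y ≡ adj y x
    adj-irr : ∀ x → adj x x ≡ false
open Graph public

Edge : ∀ {n} → Graph n → Fin n → Fin n → Set
Edge G x y = adj G x y ≡ true

ℕ→ℚ : ℕ → ℚ
ℕ→ℚ n = (+ n) / 1

_^ℚ_ : ℚ → ℕ → ℚ
q ^ℚ zero = 1ℚ
q ^ℚ suc k = q * (q ^ℚ k)

IsHom : ∀ {a b} (H : Graph a) (G : Graph b) → (Fin a → Fin b) → Set
IsHom H G f = ∀ x y → Edge H x y → Edge G (f x) (f y)

_⟶_ : ∀ {a b} → Graph a → Graph b → Set
H ⟶ G = ∃[ f ] IsHom H G f

IsCopy : ∀ {a b} (H : Graph a) (G : Graph b) → (Fin a → Fin b) → Set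
IsCopy H G f = Injective _≡_ _≡_ f × IsHom H G f

Copy : ∀ {a b} (H : Graph a) (G : Graph b) → Set
Copy H G = Σ _ (IsCopy H G)

_⊆_ : ∀ {a b} → Graph a → Graph b → Set
H ⊆ G = Copy H G

InI : ∀ {v m} → Graph v → Graph m → Set
InI H H' = (H ⟶ H') × (∀ {k} (H'' : Graph k) → H'' ⊆ H' → H ⟶ H'' → H' ⊆ H'')

IFree : ∀ {v n} → Graph v → Graph n → Set
IFree H G = ∀ {m} (H' : Graph m) → InI H H' → ¬ (H' ⊆ G)

deg : ∀ {n} → Graph n → Fin n → ℕ
deg {n} G x = sum (map (λ y → if adj G x y then 1 else 0) (allFin n))

MinDeg≥ : ∀ {n} → Graph n → ℚ → Set
MinDeg≥ {n} G γ = ∀ x → γ * ℕ→ℚ n ≤ ℕ→ℚ (deg G x)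

EdgeDisjoint : ∀ {a b} {H : Graph a} {G : Graph b} → Copy H G → Copy H G → Set
EdgeDisjoint {H = H} c d =
  ¬ (∃[ x ] ∃[ y ] ∃[ z ] ∃[ w ]
       (Edge H x y × Edge H z w × proj₁ c x ≡ proj₁ d z × proj₁ c y ≡ proj₁ d w))

Distinct : ∀ {a b} {H : Graph a} {G : Graph b} → Copy H G → Copy H G → Set
Distinct c d = ¬ (∀ x → proj₁ c x ≡ proj₁ d x)

HasEdgeDisjointCopies : ∀ {v n} (H : Graph v) (G : Graph n) → ℚ → Set
HasEdgeDisjointCopies {v} {n} H G ε =
  ∃[ cs ] (AllPairs (EdgeDisjoint {H = H} {G = G}) cs × ε * ℕ→ℚ (n ℕ.* n) ≤ ℕ→ℚ (length cs))

HasCopies : ∀ {v n} (H : Graph v) (G : Graph n) → ℚ → Set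
HasCopies {v} {n} H G δ =
  ∃[ cs ] (AllPairs (Distinct {H = H} {G = G}) cs × δ * ℕ→ℚ (n ℕ.^ v) ≤ ℕ→ℚ (length cs))

-- γ belongs to the set whose infimum is δ_poly-rem(H):
-- ∃ μ > 0, here μ = 1/(j+1), with δ(ε,H;γ) ≥ μ ε^{1/μ} for all ε ∈ (0,1].
PolyRemAt : ∀ {v} → Graph v → ℚ → Set
PolyRemAt H γ =
  Σ ℕ λ j →
    ∀ (ε : ℚ) → 0ℚ < ε → ε ≤ 1ℚ →
    ∀ n (G : Graph n) → MinDeg≥ G γ → HasEdgeDisjointCopies H G ε →
    HasCopies H G (((+ 1) / suc j) * (ε ^ℚ suc j))

-- γ belongs to the set whose infimum is δ_hom(I_H)
HomAt : ∀ {v} → Graph v → ℚ → Set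
HomAt H γ =
  Σ ℕ λ m → Σ (Graph m) λ F → IFree H F ×
    (∀ n (G : Graph n) → IFree H G → MinDeg≥ G γ → G ⟶ F)

{-# OPTIONS --safe #-}
module Submission where

-- Let F be the I_H-free target graph for minimum degree b, let a > b, and let G have
-- minimum degree at least a n and ε n² edge-disjoint copies of H. Since H does not map
-- to F, every map V(G) → V(F) violates an edge of every copy, hence at least ε n² edges.
-- A random sequence z of q = O(ε⁻²) vertices (pulled back to a graph on its q indices)
-- is then F-colourable with probability at most 1/3: revealing z vertex by vertex and
-- keeping, for each partial colouring, the lists of still available colours, the next
-- vertex shortens these lists substantially with probability Ω(ε). By a Chernoff bound,
-- z keeps minimum degree b q with probability at least 2/3. So with probability at least
-- 1/3 the sample is not I_H-free, i.e. H maps to it, and some f : V(H) → {1,…,q}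
-- becomes a homomorphism to G for a polynomial(ε) fraction of all sequences. Detaching
-- the vertices of H one at a time by Cauchy–Schwarz makes f injective at the cost of
-- squaring this density v(H) times.

open import Defs
open import Data.Bool using (Bool; true; false; if_then_else_; _∨_; _∧_; not)
import Data.Bool.Properties as Bool
open import Data.Fin as Fin using (Fin; toℕ; _↑ˡ_; punchIn; punchOut)
import Data.Fin.Properties as Fin
open import Data.Integer as ℤ using (-[1+_])
import Data.Integer.Properties as ℤ
open import Data.List using (List; []; _∷_; length; map; allFin; cartesianProduct; cartesianProductWith; filter; _++_)
open import Data.List.Membership.Propositional using (_∈_)
open import Data.List.Membership.Propositional.Properties
open import Data.List.Properties using (map-++; map-∘; map-tabulate; length-map; length-++; length-tabulate)
open import Data.List.Relation.Unary.All as All using (All; []; _∷_)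
open import Data.List.Relation.Unary.AllPairs as AllPairs using (AllPairs; []; _∷_)
import Data.List.Relation.Unary.AllPairs.Properties as AllPairs
open import Data.List.Relation.Unary.Any using (here; there)
open import Data.List.Relation.Unary.Unique.Propositional using (Unique)
import Data.List.Relation.Unary.Unique.Propositional.Properties as Unique
open import Data.Nat as ℕ hiding (_<_)
open import Data.Nat.DivMod using (m/n*n≤m; m≡m%n+[m/n]*n; m%n<n)
open import Data.Nat.Induction using (<-wellFounded)
open import Data.Nat.ListAction using (sum)
open import Data.Nat.ListAction.Properties using (sum-++)
open import Data.Nat.Properties
open import Data.Nat.Tactic.RingSolver using (solve-∀)
open import Data.Product using (Σ; ∃; ∃-syntax; _×_; _,_; proj₁; proj₂)
open import Data.Product.Properties using (,-injective)
open import Data.Rational as ℚ using (ℚ; mkℚ; 0ℚ; 1ℚ; toℚᵘ; _<_)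
import Data.Rational.Properties as ℚ
open import Data.Rational.Unnormalised as ℚᵘ using (mkℚᵘ)
import Data.Rational.Unnormalised.Properties as ℚᵘ
open import Data.Sum using (_⊎_; inj₁; inj₂)
open import Data.Unit using (⊤; tt)
open import Data.Vec as Vec using (Vec; []; _∷_; lookup; insertAt; tabulate)
open import Data.Vec.Properties using (∷-injective; insertAt-lookup; insertAt-punchIn; lookup-++ˡ; lookup∘tabulate; tabulate∘lookup; tabulate-cong)
open import Function using (_∘_; id)
open import Function.Definitions using (Injective)
open import Induction.WellFounded using (Acc; acc)
open import Relation.Binary.PropositionalEquality
open import Relation.Nullary using (¬_; yes; no; contradiction; Dec; ⌊_⌋)
open import Relation.Nullary.Decidable using (_×-dec_; _→-dec_; map′; decidable-stable; ¬?)
open import Relation.Unary using (Decidable)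

-- The inequality between the infima is taken in the form: if `b` is admissible for homomorphisms
-- and `b < t`, then some `a < t` is admissible for removal. The gap between `b` and `a` pays for
-- the loss of minimum degree in a sample.
--
-- The map from H to a sample may identify vertices of H, so the sample only yields a positive
-- density of homomorphisms to G from a quotient of H. Undoing the quotient costs a power that
-- depends on H alone; the pigeonhole over maps V(H) → {1,...,q} costs q^v(H), so q must be
-- polynomial in 1/ε. With e ≈ 1/ε, the lists have total length at most nN, where N = v(F), and
-- colouring a vertex that shortens them substantially removes at least n/(4e) of it. Hence at most
-- 4eN such vertices occur in a partial colouring, while each draw is one of them with probability
-- at least 1/(4e); this is why order e² draws suffice.
--
-- Probabilities appear as counts of sequences with denominators cleared, which keeps the estimates
-- in ℕ.

private variable
  X Y Z : Set
  n : ℕ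

-- Finite sums, Cauchy-Schwarz and averaging

ind : Bool → ℕ
ind b = if b then 1 else 0

ind≤1 : ∀ b → ind b ≤ 1
ind≤1 true  = ≤-refl
ind≤1 false = z≤n

∑ : List X → (X → ℕ) → ℕ
∑ xs f = sum (map f xs)

∑-mono : ∀ (xs : List X) {f g : X → ℕ} → (∀ x → f x ≤ g x) → ∑ xs f ≤ ∑ xs g
∑-mono []       h = z≤n
∑-mono (x ∷ xs) h = +-mono-≤ (h x) (∑-mono xs h)

∑-cong : ∀ (xs : List X) {f g : X → ℕ} → (∀ x → f x ≡ g x) → ∑ xs f ≡ ∑ xs g
∑-cong []       h = refl
∑-cong (x ∷ xs) h = cong₂ _+_ (h x) (∑-cong xs h)

∑-+ : ∀ (xs : List X) (f g : X → ℕ) → ∑ xs (λ x → f x + g x) ≡ ∑ xs f + ∑ xs g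
∑-+ []       f g = refl
∑-+ (x ∷ xs) f g = trans (cong (f x + g x +_) (∑-+ xs f g)) (swap (f x) (g x) _ _)
  where
  swap : ∀ a b c d → a + b + (c + d) ≡ a + c + (b + d)
  swap = solve-∀

∑-*ˡ : ∀ (xs : List X) c (f : X → ℕ) → ∑ xs (λ x → c * f x) ≡ c * ∑ xs f
∑-*ˡ []       c f = sym (*-zeroʳ c)
∑-*ˡ (x ∷ xs) c f = trans (cong (c * f x +_) (∑-*ˡ xs c f)) (sym (*-distribˡ-+ c (f x) _))

∑-*ʳ : ∀ (xs : List X) c (f : X → ℕ) → ∑ xs (λ x → f x * c) ≡ ∑ xs f * c
∑-*ʳ xs c f = trans (∑-cong xs (λ x → *-comm (f x) c)) (trans (∑-*ˡ xs c f) (*-comm c _))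

∑-const : ∀ (xs : List X) c → ∑ xs (λ _ → c) ≡ length xs * c
∑-const []       c = refl
∑-const (x ∷ xs) c = cong (c +_) (∑-const xs c)

∑-swap : ∀ (xs : List X) (ys : List Y) (f : X → Y → ℕ) →
         ∑ xs (λ x → ∑ ys (f x)) ≡ ∑ ys (λ y → ∑ xs (λ x → f x y))
∑-swap []       ys f = sym (trans (∑-const ys 0) (*-zeroʳ (length ys)))
∑-swap (x ∷ xs) ys f =
  trans (cong (∑ ys (f x) +_) (∑-swap xs ys f)) (sym (∑-+ ys (f x) _))

∑-product : ∀ (xs : List X) (ys : List Y) (p : X → Y → Z) (f : Z → ℕ) →
            ∑ (cartesianProductWith p xs ys) f ≡ ∑ xs (λ x → ∑ ys (λ y → f (p x y)))
∑-product []       ys p f = refl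
∑-product (x ∷ xs) ys p f = begin
  sum (map f (map (p x) ys ++ rest))        ≡⟨ cong sum (map-++ f (map (p x) ys) rest) ⟩
  sum (map f (map (p x) ys) ++ map f rest)  ≡⟨ sum-++ (map f (map (p x) ys)) _ ⟩
  sum (map f (map (p x) ys)) + ∑ rest f     ≡⟨ cong₂ _+_ (cong sum (sym (map-∘ ys))) (∑-product xs ys p f) ⟩
  ∑ ys (λ y → f (p x y)) + _                ∎
  where
  open ≡-Reasoning
  rest = cartesianProductWith p xs ys

∈⇒≤∑ : ∀ {xs : List X} (f : X → ℕ) {x} → x ∈ xs → f x ≤ ∑ xs f
∈⇒≤∑ f (here refl) = m≤m+n _ _
∈⇒≤∑ f (there i)   = ≤-trans (∈⇒≤∑ f i) (m≤n+m _ _)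

2ab≤a²+b² : ∀ a b → 2 * (a * b) ≤ a * a + b * b
2ab≤a²+b² zero    b       = z≤n
2ab≤a²+b² (suc a) zero    rewrite *-zeroʳ a = z≤n
2ab≤a²+b² (suc a) (suc b) = subst₂ _≤_ (e₁ a b) (e₂ a b) (+-monoˡ-≤ (2 + 2 * a + 2 * b) (2ab≤a²+b² a b))
  where
  e₁ : ∀ a b → 2 * (a * b) + (2 + 2 * a + 2 * b) ≡ 2 * (suc a * suc b)
  e₁ = solve-∀
  e₂ : ∀ a b → a * a + b * b + (2 + 2 * a + 2 * b) ≡ suc a * suc a + suc b * suc b
  e₂ = solve-∀

cauchy-schwarz : ∀ (xs : List X) (f : X → ℕ) → ∑ xs f * ∑ xs f ≤ length xs * ∑ xs (λ x → f x * f x)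
cauchy-schwarz []       f = z≤n
cauchy-schwarz (x ∷ xs) f = begin
  (a + s) * (a + s)                              ≡⟨ e₁ a s ⟩
  a * a + 2 * (a * s) + s * s                    ≤⟨ +-mono-≤ (+-monoʳ-≤ (a * a) cross) (cauchy-schwarz xs f) ⟩
  a * a + (l * (a * a) + t) + l * t              ≡⟨ e₂ a l t ⟩
  suc l * (a * a + t)                            ∎
  where
  open ≤-Reasoning
  a = f x
  s = ∑ xs f
  t = ∑ xs (λ x → f x * f x)
  l = length xs
  e₁ : ∀ a s → (a + s) * (a + s) ≡ a * a + 2 * (a * s) + s * s
  e₁ = solve-∀
  e₂ : ∀ a l t → a * a + (l * (a * a) + t) + l * t ≡ suc l * (a * a + t)
  e₂ = solve-∀
  cross : 2 * (a * s) ≤ l * (a * a) + t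
  cross = begin
    2 * (a * s)                            ≡⟨ sym (*-assoc 2 a s) ⟩
    2 * a * s                              ≡⟨ sym (∑-*ˡ xs (2 * a) f) ⟩
    ∑ xs (λ y → 2 * a * f y)               ≤⟨ ∑-mono xs (λ y → subst (_≤ a * a + f y * f y) (sym (*-assoc 2 a (f y))) (2ab≤a²+b² a (f y))) ⟩
    ∑ xs (λ y → a * a + f y * f y)         ≡⟨ ∑-+ xs _ _ ⟩
    ∑ xs (λ _ → a * a) + t                 ≡⟨ cong (_+ t) (∑-const xs _) ⟩
    l * (a * a) + t                        ∎

-- Keeping the factor `L` apart from the length of the list lets the induction discard an element
-- whose value is below average.
weighted-pigeonhole : ∀ L (x : X) xs (f : X → ℕ) {s} →
                      length (x ∷ xs) * s ≤ L * ∑ (x ∷ xs) f → ∃[ y ] s ≤ L * f y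
weighted-pigeonhole L x []       f {s} h =
  x , subst₂ _≤_ (+-identityʳ s) (cong (L *_) (+-identityʳ (f x))) h
weighted-pigeonhole L x (y ∷ ys) f {s} h with s ≤? L * f x
... | yes p = x , p
... | no ¬p = weighted-pigeonhole L y ys f (+-cancelˡ-≤ s _ _ (≤-trans h (begin
    L * (f x + ∑ (y ∷ ys) f)      ≡⟨ *-distribˡ-+ L (f x) _ ⟩
    L * f x + L * ∑ (y ∷ ys) f    ≤⟨ +-monoˡ-≤ _ (<⇒≤ (≰⇒> ¬p)) ⟩
    s + L * ∑ (y ∷ ys) f          ∎)))
  where open ≤-Reasoning

pigeonhole : ∀ (xs : List X) (f : X → ℕ) {s} → 0 ℕ.< s → s ≤ ∑ xs f → ∃[ x ] s ≤ length xs * f x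
pigeonhole []       f 0<s s≤ = contradiction s≤ (<⇒≱ 0<s)
pigeonhole (x ∷ xs) f 0<s s≤ = weighted-pigeonhole (length (x ∷ xs)) x xs f (*-monoʳ-≤ (length (x ∷ xs)) s≤)

-- Sums over vertices and over sequences of vertices

length-allFin : ∀ n → length (allFin n) ≡ n
length-allFin n = length-tabulate id

∑ᶠ : (Fin n → ℕ) → ℕ
∑ᶠ {n} f = ∑ (allFin n) f

∑ᶠ-const : ∀ n c → ∑ᶠ {n} (λ _ → c) ≡ n * c
∑ᶠ-const n c = trans (∑-const (allFin n) c) (cong (_* c) (length-allFin n))

∑ᶠ-bound : ∀ {f : Fin n → ℕ} {c} → (∀ x → f x ≤ c) → ∑ᶠ f ≤ n * c
∑ᶠ-bound {n} {f} {c} h = subst (∑ᶠ f ≤_) (∑ᶠ-const n c) (∑-mono (allFin n) h)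

≤∑ᶠ : ∀ (f : Fin n → ℕ) x → f x ≤ ∑ᶠ f
≤∑ᶠ f x = ∈⇒≤∑ f (∈-allFin x)

vecs : ∀ n q → List (Vec (Fin n) q)
vecs n zero    = [] ∷ []
vecs n (suc q) = cartesianProductWith _∷_ (allFin n) (vecs n q)

vecs-unique : ∀ n q → Unique (vecs n q)
vecs-unique n zero    = All.[] ∷ []
vecs-unique n (suc q) = Unique.cartesianProductWith⁺ _∷_ ∷-injective (Unique.allFin⁺ n) (vecs-unique n q)

∈-vecs : ∀ {n q} (z : Vec (Fin n) q) → z ∈ vecs n q
∈-vecs []      = here refl
∈-vecs (x ∷ z) = ∈-cartesianProductWith⁺ _∷_ (∈-allFin x) (∈-vecs z)

∑ᵛ : ∀ {q} → (Vec (Fin n) q → ℕ) → ℕ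
∑ᵛ {n} {q} f = ∑ (vecs n q) f

∑ᵛ-suc : ∀ {q} (f : Vec (Fin n) (suc q) → ℕ) → ∑ᵛ f ≡ ∑ᶠ (λ x → ∑ᵛ (λ z → f (x ∷ z)))
∑ᵛ-suc {n} {q} f = ∑-product (allFin n) (vecs n q) _∷_ f

∑ᵛ-const : ∀ {n} q c → ∑ᵛ {n} {q} (λ _ → c) ≡ n ^ q * c
∑ᵛ-const {n} zero    c = refl
∑ᵛ-const {n} (suc q) c = begin
  ∑ᵛ {n} {suc q} (λ _ → c)             ≡⟨ ∑ᵛ-suc {n} {q} _ ⟩
  ∑ᶠ {n} (λ _ → ∑ᵛ {n} {q} (λ _ → c))  ≡⟨ ∑ᶠ-const n _ ⟩
  n * ∑ᵛ {n} {q} (λ _ → c)             ≡⟨ cong (n *_) (∑ᵛ-const q c) ⟩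
  n * (n ^ q * c)                      ≡⟨ sym (*-assoc n _ c) ⟩
  n * n ^ q * c                        ∎
  where open ≡-Reasoning

length-vecs : ∀ n q → length (vecs n q) ≡ n ^ q
length-vecs n q = begin
  length (vecs n q)          ≡⟨ sym (*-identityʳ _) ⟩
  length (vecs n q) * 1      ≡⟨ sym (∑-const (vecs n q) 1) ⟩
  ∑ᵛ {n} {q} (λ _ → 1)       ≡⟨ ∑ᵛ-const q 1 ⟩
  n ^ q * 1                  ≡⟨ *-identityʳ _ ⟩
  n ^ q                      ∎
  where open ≡-Reasoning

∑ᵛ-insertAt : ∀ {q} (f : Vec (Fin n) (suc q) → ℕ) i →
              ∑ᵛ f ≡ ∑ᶠ (λ x → ∑ᵛ (λ z → f (insertAt z i x)))
∑ᵛ-insertAt {n} {q}     f Fin.zero    = ∑ᵛ-suc f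
∑ᵛ-insertAt {n} {suc q} f (Fin.suc i) = begin
  ∑ᵛ f                                                               ≡⟨ ∑ᵛ-suc f ⟩
  ∑ᶠ (λ y → ∑ᵛ (λ z → f (y ∷ z)))                                    ≡⟨ ∑-cong (allFin n) (λ y → ∑ᵛ-insertAt (λ z → f (y ∷ z)) i) ⟩
  ∑ᶠ (λ y → ∑ᶠ (λ x → ∑ᵛ (λ z → f (y ∷ insertAt z i x))))            ≡⟨ ∑-swap (allFin n) (allFin n) _ ⟩
  ∑ᶠ (λ x → ∑ᶠ (λ y → ∑ᵛ (λ z → f (y ∷ insertAt z i x))))            ≡⟨ ∑-cong (allFin n) (λ x → sym (∑ᵛ-suc (λ z → f (insertAt z (Fin.suc i) x)))) ⟩
  ∑ᶠ (λ x → ∑ᵛ (λ z → f (insertAt z (Fin.suc i) x)))                 ∎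
  where open ≡-Reasoning

∑ᵛ-++ : ∀ p {q} (f : Vec (Fin n) (p + q) → ℕ) → ∑ᵛ f ≡ ∑ᵛ {n} {p} (λ y → ∑ᵛ {n} {q} (λ z → f (y Vec.++ z)))
∑ᵛ-++ zero    f = sym (+-identityʳ _)
∑ᵛ-++ {n} (suc p) f = trans (∑ᵛ-suc f) (trans (∑-cong (allFin n) (λ x → ∑ᵛ-++ p (λ z → f (x ∷ z)))) (sym (∑ᵛ-suc {n} {p} _)))

-- The head of `xs` is cut out of `ys` at an occurrence; the remaining entries of `xs` differ from
-- it and survive the cut.
unique⊆⇒length≤ : ∀ {xs ys : List X} → Unique xs → (∀ {x} → x ∈ xs → x ∈ ys) → length xs ≤ length ys
unique⊆⇒length≤ {xs = []}     _          _  = z≤n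
unique⊆⇒length≤ {xs = x ∷ xs} (x∉ ∷ uxs) xs⊆ with ∈-∃++ (xs⊆ (here refl))
... | as , bs , refl = begin
    suc (length xs)               ≤⟨ s≤s (unique⊆⇒length≤ uxs xs⊆as++bs) ⟩
    suc (length (as ++ bs))       ≡⟨ cong suc (length-++ as) ⟩
    suc (length as + length bs)   ≡⟨ sym (+-suc (length as) (length bs)) ⟩
    length as + length (x ∷ bs)   ≡⟨ sym (length-++ as) ⟩
    length (as ++ x ∷ bs)         ∎
  where
  open ≤-Reasoning
  xs⊆as++bs : ∀ {y} → y ∈ xs → y ∈ as ++ bs
  xs⊆as++bs y∈ with ∈-++⁻ as (xs⊆ (there y∈))
  ... | inj₁ y∈as         = ∈-++⁺ˡ y∈as
  ... | inj₂ (here refl)  = contradiction refl (All.lookup x∉ y∈)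
  ... | inj₂ (there y∈bs) = ∈-++⁺ʳ as y∈bs

select : (X → Bool) → List X → List X
select p = filter (λ x → p x Bool.≟ true)

∈-select⁻ : ∀ (p : X → Bool) xs {x} → x ∈ select p xs → p x ≡ true
∈-select⁻ p xs = proj₂ ∘ ∈-filter⁻ (λ x → p x Bool.≟ true) {xs = xs}

∑-ind : ∀ (p : X → Bool) xs → ∑ xs (ind ∘ p) ≡ length (select p xs)
∑-ind p []       = refl
∑-ind p (x ∷ xs) with p x
... | true  = cong suc (∑-ind p xs)
... | false = ∑-ind p xs

pairs : ∀ n → List (Fin n × Fin n)
pairs n = cartesianProduct (allFin n) (allFin n)

∈-pairs : ∀ (z : Fin n × Fin n) → z ∈ pairs n
∈-pairs (x , y) = ∈-cartesianProduct⁺ (∈-allFin x) (∈-allFin y)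

unique⇒length≤∑pairs : ∀ (p : Fin n → Fin n → Bool) {zs : List (Fin n × Fin n)} → Unique zs →
                       (∀ {x y} → (x , y) ∈ zs → p x y ≡ true) →
                       length zs ≤ ∑ᶠ (λ x → ∑ᶠ (λ y → ind (p x y)))
unique⇒length≤∑pairs {n} p {zs} u h = begin
  length zs                                         ≤⟨ unique⊆⇒length≤ u (λ {z} z∈ → ∈-filter⁺ _ (∈-pairs z) (h z∈)) ⟩
  length (select p′ (pairs n))                      ≡⟨ sym (∑-ind p′ (pairs n)) ⟩
  ∑ (pairs n) (ind ∘ p′)                            ≡⟨ ∑-product (allFin n) (allFin n) _,_ _ ⟩
  ∑ᶠ (λ x → ∑ᶠ (λ y → ind (p x y)))                 ∎
  where
  open ≤-Reasoning
  p′ : Fin n × Fin n → Bool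
  p′ (x , y) = p x y

-- Freeness of the minimal family as absence of a homomorphism

-- The diagonal represents the vertices, so that one statement about pairs covers vertices and edges
-- alike.
adj⁼ : Graph n → Fin n → Fin n → Bool
adj⁼ G x y = adj G x y ∨ ⌊ x Fin.≟ y ⌋

-- Both deleting a vertex and deleting an edge decrease this count.
size : Graph n → ℕ
size G = ∑ᶠ (λ x → ∑ᶠ (λ y → ind (adj⁼ G x y)))

adj⁼⁻ : ∀ (G : Graph n) {x y} → adj⁼ G x y ≡ true → Edge G x y ⊎ x ≡ y
adj⁼⁻ G {x} {y} h with adj G x y | x Fin.≟ y
... | true  | _     = inj₁ refl
... | false | yes p = inj₂ p

adj⁼-refl : ∀ (G : Graph n) x → adj⁼ G x x ≡ true
adj⁼-refl G x with x Fin.≟ x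
... | yes _  = Bool.∨-zeroʳ (adj G x x)
... | no x≢x = contradiction refl x≢x

adj⁼-edge : ∀ (G : Graph n) {x y} → Edge G x y → adj⁼ G x y ≡ true
adj⁼-edge G e rewrite e = refl

covers? : ∀ {k m} (A : Graph k) (c : Fin k → Fin m) x y →
          Dec (∃[ u ] ∃[ w ] (adj⁼ A u w ≡ true × c u ≡ x × c w ≡ y))
covers? A c x y =
  Fin.any? λ u → Fin.any? λ w → (adj⁼ A u w Bool.≟ true) ×-dec (c u Fin.≟ x) ×-dec (c w Fin.≟ y)

-- If the embedding misses a vertex or an edge of `B`, the missed pair comes on top of the images of
-- the pairs counted for `A`. If it misses nothing, its inverse embeds `B` into `A`.
⊆⇒⊇⊎size< : ∀ {k m} {A : Graph k} {B : Graph m} → A ⊆ B → B ⊆ A ⊎ size A ℕ.< size B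
⊆⇒⊇⊎size< {k} {m} {A} {B} (c , c-inj , c-hom)
  with Fin.any? (λ x → Fin.any? (λ y → (adj⁼ B x y Bool.≟ true) ×-dec ¬? (covers? A c x y)))
... | yes (x , y , xy , ¬hit) = inj₂ (begin
    suc (size A)                    ≡⟨ cong suc (sym (∑-product (allFin k) (allFin k) _,_ _)) ⟩
    suc (∑ (pairs k) (ind ∘ p))     ≡⟨ cong suc (∑-ind p (pairs k)) ⟩
    suc (length as)                 ≡⟨ cong suc (sym (length-map c² as)) ⟩
    length ((x , y) ∷ map c² as)    ≤⟨ unique⇒length≤∑pairs (adj⁼ B) (All.tabulate fresh ∷ Unique.map⁺ c²-inj as-unique) all ⟩
    size B                          ∎)
  where
  open ≤-Reasoning
  p : Fin k × Fin k → Bool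
  p (u , w) = adj⁼ A u w
  as = select p (pairs k)
  as-unique = Unique.filter⁺ (λ z → p z Bool.≟ true) (Unique.cartesianProduct⁺ (Unique.allFin⁺ k) (Unique.allFin⁺ k))
  c² : Fin k × Fin k → Fin m × Fin m
  c² (u , w) = c u , c w
  c²-inj : ∀ {z z′} → c² z ≡ c² z′ → z ≡ z′
  c²-inj eq with e₁ , e₂ ← ,-injective eq = cong₂ _,_ (c-inj e₁) (c-inj e₂)
  fresh : ∀ {z} → z ∈ map c² as → (x , y) ≢ z
  fresh z∈ refl with (u , w) , uw∈ , eq ← ∈-map⁻ c² z∈
    with e₁ , e₂ ← ,-injective eq = ¬hit (u , w , ∈-select⁻ p (pairs k) uw∈ , sym e₁ , sym e₂)
  all : ∀ {x′ y′} → (x′ , y′) ∈ (x , y) ∷ map c² as → adj⁼ B x′ y′ ≡ true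
  all (here refl) = xy
  all (there z∈) with (u , w) , uw∈ , refl ← ∈-map⁻ c² z∈
    with adj⁼⁻ A {u} {w} (∈-select⁻ p (pairs k) uw∈)
  ... | inj₁ e    = adj⁼-edge B (c-hom u w e)
  ... | inj₂ refl = adj⁼-refl B (c u)
... | no ¬miss = inj₁ (d , d-inj , d-hom)
  where
  hit : ∀ x y → adj⁼ B x y ≡ true → ∃[ u ] ∃[ w ] (adj⁼ A u w ≡ true × c u ≡ x × c w ≡ y)
  hit x y xy = decidable-stable (covers? A c x y) (λ ¬hit → ¬miss (x , y , xy , ¬hit))
  d : Fin m → Fin k
  d x = proj₁ (hit x x (adj⁼-refl B x))
  c∘d : ∀ x → c (d x) ≡ x
  c∘d x = proj₁ (proj₂ (proj₂ (proj₂ (hit x x (adj⁼-refl B x)))))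
  d-inj : ∀ {x y} → d x ≡ d y → x ≡ y
  d-inj {x} {y} eq = trans (sym (c∘d x)) (trans (cong c eq) (c∘d y))
  d-hom : IsHom B A d
  d-hom x y e with u , w , uw , cu , cw ← hit x y (adj⁼-edge B e)
    with adj⁼⁻ A uw
  ... | inj₁ e′   = subst₂ (Edge A) (c-inj (trans cu (sym (c∘d x)))) (c-inj (trans cw (sym (c∘d y)))) e′
  ... | inj₂ refl = contradiction (trans (sym e) (trans (cong (adj B x) (trans (sym cw) cu)) (adj-irr B x))) λ ()

⊆-trans : ∀ {a b c} {A : Graph a} {B : Graph b} {C : Graph c} → A ⊆ B → B ⊆ C → A ⊆ C
⊆-trans (f , f-inj , f-hom) (g , g-inj , g-hom) =
  g ∘ f , f-inj ∘ g-inj , λ x y e → g-hom _ _ (f-hom x y e)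

⟶-trans : ∀ {a b c} {A : Graph a} {B : Graph b} {C : Graph c} → A ⟶ B → B ⟶ C → A ⟶ C
⟶-trans (f , f-hom) (g , g-hom) = g ∘ f , λ x y e → g-hom _ _ (f-hom x y e)

¬⟶⇒IFree : ∀ {v} {H : Graph v} {G : Graph n} → ¬ (H ⟶ G) → IFree H G
¬⟶⇒IFree {H = H} {G} ¬hom H′ (H⟶H′ , _) (c , _ , c-hom) =
  ¬hom (⟶-trans {A = H} {H′} {G} H⟶H′ (c , c-hom))

-- Descent on `size`. A strictly smaller subgraph of `A` cannot receive `H`, since it would inherit
-- freeness; so if `H` maps to `A`, then `A` is minimal and is itself forbidden.
IFree⇒¬⟶ : ∀ {v} {H : Graph v} {G : Graph n} → IFree H G → ¬ (H ⟶ G)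
IFree⇒¬⟶ {H = H} {G} = go G (<-wellFounded (size G))
  where
  go : ∀ {k} (A : Graph k) → Acc ℕ._<_ (size A) → IFree H A → ¬ (H ⟶ A)
  go A (acc rec) free H⟶A = free A (H⟶A , minimal) (id , id , λ _ _ e → e)
    where
    minimal : ∀ {k} (B : Graph k) → B ⊆ A → H ⟶ B → A ⊆ B
    minimal B B⊆A H⟶B with ⊆⇒⊇⊎size< {A = B} {A} B⊆A
    ... | inj₁ A⊆B = A⊆B
    ... | inj₂ lt  = contradiction H⟶B
      (go B (rec lt) λ H′ H′∈I H′⊆B → free H′ H′∈I (⊆-trans {A = H′} {B} {A} H′⊆B B⊆A))

-- Edges violated by a map to the target graph

# : Dec X → ℕ
# p = ind ⌊ p ⌋

1≤# : (p : Dec X) → X → 1 ≤ # p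
1≤# (yes _) _ = ≤-refl
1≤# (no ¬p) p = contradiction p ¬p

#≤ : (p : Dec X) {m : ℕ} → (X → 1 ≤ m) → # p ≤ m
#≤ (yes p) h = h p
#≤ (no _)  h = z≤n

#-mono : (p : Dec X) (q : Dec Y) → (X → Y) → # p ≤ # q
#-mono p q f = #≤ p (1≤# q ∘ f)

violated : ∀ {N} → Graph n → Graph N → (Fin n → Fin N) → Fin n → Fin n → Bool
violated G F φ x y = adj G x y ∧ not (adj F (φ x) (φ y))

-- A copy followed by `φ` cannot be a homomorphism, so each copy has an edge that `φ` violates;
-- edge-disjointness makes the chosen ordered pairs distinct.
edgeDisjoint⇒violated : ∀ {v N} {H : Graph v} {G : Graph n} {F : Graph N} → ¬ (H ⟶ F) →
                        {cs : List (Copy H G)} → AllPairs (EdgeDisjoint {H = H} {G = G}) cs →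
                        ∀ φ → length cs ≤ ∑ᶠ (λ x → ∑ᶠ (λ y → ind (violated G F φ x y)))
edgeDisjoint⇒violated {n} {H = H} {G} {F} ¬hom {cs} disjoint φ =
  subst (_≤ _) (length-map pair cs) (unique⇒length≤∑pairs (violated G F φ) unique violates)
  where
  pick : ∀ (c : Copy H G) → ∃[ u ] ∃[ w ] (Edge H u w × adj F (φ (proj₁ c u)) (φ (proj₁ c w)) ≡ false)
  pick (c , _ , _) = decidable-stable
    (Fin.any? λ u → Fin.any? λ w → (adj H u w Bool.≟ true) ×-dec (adj F (φ (c u)) (φ (c w)) Bool.≟ false))
    λ none → ¬hom (φ ∘ c , λ u w e → Bool.¬-not λ f → none (u , w , e , f))
  pair : Copy H G → Fin n × Fin n
  pair c = proj₁ c (proj₁ (pick c)) , proj₁ c (proj₁ (proj₂ (pick c)))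
  unique = AllPairs.map⁺ (AllPairs.map
    (λ {c} {d} disj eq → disj (_ , _ , _ , _ , proj₁ (proj₂ (proj₂ (pick c))) , proj₁ (proj₂ (proj₂ (pick d)))
                              , proj₁ (,-injective eq) , proj₂ (,-injective eq)))
    disjoint)
  violates : ∀ {x y} → (x , y) ∈ map pair cs → violated G F φ x y ≡ true
  violates z∈ with c , _ , refl ← ∈-map⁻ pair z∈
    with u , w , e , f ← pick c = cong₂ _∧_ (proj₂ (proj₂ c) u w e) (cong not f)

-- Equal entries of `z` become nonadjacent twins, so repetitions need no separate treatment and
-- there are always exactly `q` vertices.
pullback : ∀ {q} → Graph n → Vec (Fin n) q → Graph q
pullback G z .adj i j     = adj G (lookup z i) (lookup z j)
pullback G z .adj-sym i j = adj-sym G _ _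
pullback G z .adj-irr i   = adj-irr G _

-- Colouring a random sequence from shrinking lists

module ListColoring {n N} (G : Graph n) (F : Graph N) where

  -- Lists are kept for all vertices of `G`, sampled or not: this is what lets one coloured vertex
  -- cause a loss on the scale of `n`.
  Lists : Set
  Lists = Fin n → Fin N → Bool

  conflict : Fin n → Fin N → Fin n → Fin N → Bool
  conflict x c y d = adj G x y ∧ not (adj F c d)

  restrict : Lists → Fin n → Fin N → Lists
  restrict L x c y d = L y d ∧ not (conflict x c y d)

  Colorable : ∀ {r} → Lists → Vec (Fin n) r → Set
  Colorable L []      = ⊤
  Colorable L (x ∷ z) = ∃[ c ] (L x c ≡ true × Colorable (restrict L x c) z)

  colorable? : ∀ {r} L (z : Vec (Fin n) r) → Dec (Colorable L z)
  colorable? L []      = yes tt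
  colorable? L (x ∷ z) = Fin.any? λ c → (L x c Bool.≟ true) ×-dec colorable? (restrict L x c) z

  Colorable-mono : ∀ {r} {L L′ : Lists} → (∀ x c → L x c ≡ true → L′ x c ≡ true) →
                   (z : Vec (Fin n) r) → Colorable L z → Colorable L′ z
  Colorable-mono L⊆L′ []      _ = tt
  Colorable-mono {L = L} {L′} L⊆L′ (x ∷ z) (c , Lxc , col) = c , L⊆L′ x c Lxc , Colorable-mono sub z col
    where
    sub : ∀ y d → restrict L x c y d ≡ true → restrict L′ x c y d ≡ true
    sub y d h with L y d in Lyd
    ... | true rewrite L⊆L′ y d Lyd = h

  Colorable-tail : ∀ {r} {L : Lists} x (z : Vec (Fin n) r) → Colorable L (x ∷ z) → Colorable L z
  Colorable-tail {L = L} x z (c , _ , col) = Colorable-mono (λ y d h → Bool.∧-conicalˡ (L y d) _ h) z col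

  hom⇒Colorable : ∀ {r} {L : Lists} (z : Vec (Fin n) r) (ψ : Fin r → Fin N) → IsHom (pullback G z) F ψ →
                  (∀ i → L (lookup z i) (ψ i) ≡ true) → Colorable L z
  hom⇒Colorable []      ψ hom ok = tt
  hom⇒Colorable {L = L} (x ∷ z) ψ hom ok =
    ψ Fin.zero , ok Fin.zero , hom⇒Colorable z (ψ ∘ Fin.suc) (λ i j → hom (Fin.suc i) (Fin.suc j)) ok′
    where
    ok′ : ∀ i → restrict L x (ψ Fin.zero) (lookup z i) (ψ (Fin.suc i)) ≡ true
    ok′ i rewrite ok (Fin.suc i) with adj G x (lookup z i) in e
    ... | false = refl
    ... | true rewrite hom Fin.zero (Fin.suc i) e = refl

  -- The potential function: at most `n * N`, and never increasing along a partial colouring.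
  weight : Lists → ℕ
  weight L = ∑ᶠ (λ y → ∑ᶠ (λ d → ind (L y d)))

  loss : Lists → Fin n → Fin N → ℕ
  loss L x c = ∑ᶠ (λ y → ∑ᶠ (λ d → ind (L y d ∧ conflict x c y d)))

  weight-restrict : ∀ L x c → weight (restrict L x c) + loss L x c ≡ weight L
  weight-restrict L x c = sym (trans
    (∑-cong (allFin n) (λ y → trans (∑-cong (allFin N) (λ d → split (L y d) (conflict x c y d))) (∑-+ (allFin N) _ _)))
    (∑-+ (allFin n) _ _))
    where
    split : ∀ a b → ind a ≡ ind (a ∧ not b) + ind (a ∧ b)
    split true  true  = refl
    split true  false = refl
    split false b     = refl

  module Sampling {e} (0<e : 0 ℕ.< e) (0<n : 0 ℕ.< n)
                  (far : ∀ φ → n * n ≤ e * ∑ᶠ (λ x → ∑ᶠ (λ y → ind (violated G F φ x y)))) where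

    -- Colouring such a vertex, in whatever way, either is impossible or
    -- shortens the lists of the others considerably.
    Restricting : Lists → Fin n → Set
    Restricting L x = ∀ c → L x c ≡ true → n ≤ 4 * e * loss L x c

    restricting? : ∀ L x → Dec (Restricting L x)
    restricting? L x = Fin.all? λ c → (L x c Bool.≟ true) →-dec (n ≤? 4 * e * loss L x c)

    ¬restricting⇒color : ∀ L x → ¬ Restricting L x → ∃[ c ] (L x c ≡ true × 4 * e * loss L x c ℕ.< n)
    ¬restricting⇒color L x ¬r with c , ¬h ← Fin.¬∀⟶∃¬ N _ (λ c → (L x c Bool.≟ true) →-dec (n ≤? 4 * e * loss L x c)) ¬r
      with L x c in eq
    ... | true  = c , eq , ≰⇒> (λ p → ¬h (λ _ → p))
    ... | false = contradiction (λ ()) ¬h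

    -- Otherwise colour every non-restricting vertex by a colour of small loss:
    -- too few edges are violated.
    many-restricting : ∀ L → n ≤ 4 * e * ∑ᶠ (λ x → # (restricting? L x))
    many-restricting L = ≮⇒≥ few⇒⊥
      where
      open ≤-Reasoning
      g = ∑ᶠ (λ x → # (restricting? L x))
      few⇒⊥ : ¬ (4 * e * g ℕ.< n)
      -- With fewer than n/(4e) restricting vertices, the pairs that meet them number less than
      -- 2n²/(4e), and the others cost at most n/(4e) per first vertex. So 4e times the number of
      -- violated pairs is at most 3n², against 4n² from `far`.
      few⇒⊥ few = <⇒≱ (*-mono-< 0<n 0<n) (+-cancelʳ-≤ (3 * (n * n)) (n * n) 0 (begin
          n * n + 3 * (n * n)                     ≡⟨ e₄ (n * n) ⟩
          4 * (n * n)                             ≤⟨ *-monoʳ-≤ 4 (far φ) ⟩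
          4 * (e * ∑ᶠ (λ x → ∑ᶠ (λ y → ind (violated G F φ x y))))
                                                  ≡⟨ sym (*-assoc 4 e _) ⟩
          4 * e * ∑ᶠ (λ x → ∑ᶠ (λ y → ind (violated G F φ x y)))
                                                  ≤⟨ *-monoʳ-≤ (4 * e) violated-bound ⟩
          4 * e * (n * g + n * g + ∑ᶠ waste)      ≡⟨ e₃ (4 * e) n g (∑ᶠ waste) ⟩
          2 * (n * (4 * e * g)) + 4 * e * ∑ᶠ waste
                                                  ≡⟨ cong (2 * (n * (4 * e * g)) +_) (sym (∑-*ˡ (allFin n) (4 * e) waste)) ⟩
          2 * (n * (4 * e * g)) + ∑ᶠ (λ x → 4 * e * waste x)
                                                  ≤⟨ +-mono-≤ (*-monoʳ-≤ 2 (*-monoʳ-≤ n (<⇒≤ few))) (∑ᶠ-bound 4ewaste≤n) ⟩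
          2 * (n * n) + n * n                     ≡⟨ e₂ (n * n) ⟩
          0 + 3 * (n * n)                         ∎))
        where
        e₄ : ∀ a → a + 3 * a ≡ 4 * a
        e₄ = solve-∀
        e₃ : ∀ a n g w → a * (n * g + n * g + w) ≡ 2 * (n * (a * g)) + a * w
        e₃ = solve-∀
        e₂ : ∀ a → 2 * a + a ≡ 0 + 3 * a
        e₂ = solve-∀

        free : ∃[ x ] ¬ Restricting L x
        free = Fin.¬∀⟶∃¬ n _ (restricting? L) λ all → <⇒≱ few (begin
          n                          ≡⟨ sym (trans (∑ᶠ-const n 1) (*-identityʳ n)) ⟩
          ∑ᶠ {n} (λ _ → 1)           ≤⟨ ∑-mono (allFin n) (λ x → 1≤# (restricting? L x) (all x)) ⟩
          g                          ≤⟨ m≤n*m g (4 * e) {{m*n≢0 4 e {{_}} {{>-nonZero 0<e}}}} ⟩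
          4 * e * g                  ∎)

        choose : ∀ x → Restricting L x ⊎ ∃[ c ] (L x c ≡ true × 4 * e * loss L x c ℕ.< n)
        choose x with restricting? L x
        ... | yes r = inj₁ r
        ... | no ¬r = inj₂ (¬restricting⇒color L x ¬r)

        φ : Fin n → Fin N
        φ x with choose x
        -- Pairs at a restricting vertex are paid for in full, so any colour will do; one exists
        -- because some vertex is not restricting.
        ... | inj₁ _       = proj₁ (¬restricting⇒color L (proj₁ free) (proj₂ free))
        ... | inj₂ (c , _) = c

        φ-spec : ∀ x → Restricting L x ⊎ (L x (φ x) ≡ true × 4 * e * loss L x (φ x) ℕ.< n)
        φ-spec x with choose x
        ... | inj₁ r       = inj₁ r
        ... | inj₂ (c , h) = inj₂ h

        waste : Fin n → ℕ
        waste x with φ-spec x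
        ... | inj₁ _ = 0
        ... | inj₂ _ = loss L x (φ x)

        4ewaste≤n : ∀ x → 4 * e * waste x ≤ n
        4ewaste≤n x with φ-spec x
        ... | inj₁ _       = subst (_≤ n) (sym (*-zeroʳ (4 * e))) z≤n
        ... | inj₂ (_ , h) = <⇒≤ h

        waste′ : Fin n → Fin n → ℕ
        waste′ x y with φ-spec x
        ... | inj₁ _ = 0
        ... | inj₂ _ = ∑ᶠ (λ d → ind (L y d ∧ conflict x (φ x) y d))

        ∑waste′ : ∀ x → ∑ᶠ (waste′ x) ≡ waste x
        ∑waste′ x with φ-spec x
        ... | inj₁ _ = trans (∑ᶠ-const n 0) (*-zeroʳ n)
        ... | inj₂ _ = refl

        pointwise : ∀ x y → ind (violated G F φ x y) ≤ # (restricting? L x) + # (restricting? L y) + waste′ x y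
        pointwise x y with φ-spec x | φ-spec y
        ... | inj₁ r | _ = begin
          ind (violated G F φ x y)                          ≤⟨ ind≤1 _ ⟩
          1                                                 ≤⟨ 1≤# (restricting? L x) r ⟩
          # (restricting? L x)                              ≤⟨ m≤m+n _ _ ⟩
          # (restricting? L x) + # (restricting? L y)       ≤⟨ m≤m+n _ _ ⟩
          # (restricting? L x) + # (restricting? L y) + 0   ∎
        ... | inj₂ _ | inj₁ r = begin
          ind (violated G F φ x y)                          ≤⟨ ind≤1 _ ⟩
          1                                                 ≤⟨ 1≤# (restricting? L y) r ⟩
          # (restricting? L y)                              ≤⟨ m≤n+m _ _ ⟩
          # (restricting? L x) + # (restricting? L y)       ≤⟨ m≤m+n _ _ ⟩
          _                                                 ∎
        -- The colour of `y` is on its list, so a violated pair is one of the entries that colouring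
        -- `x` deletes.
        ... | inj₂ _ | inj₂ (Lyφy , _) = begin
          ind (violated G F φ x y)                          ≡⟨ cong (λ b → ind (b ∧ violated G F φ x y)) (sym Lyφy) ⟩
          ind (L y (φ y) ∧ conflict x (φ x) y (φ y))        ≤⟨ ≤∑ᶠ (λ d → ind (L y d ∧ conflict x (φ x) y d)) (φ y) ⟩
          ∑ᶠ (λ d → ind (L y d ∧ conflict x (φ x) y d))     ≤⟨ m≤n+m _ _ ⟩
          _                                                 ∎

        violated-bound : ∑ᶠ (λ x → ∑ᶠ (λ y → ind (violated G F φ x y))) ≤ n * g + n * g + ∑ᶠ waste
        violated-bound = begin
          ∑ᶠ (λ x → ∑ᶠ (λ y → ind (violated G F φ x y)))
            ≤⟨ ∑-mono (allFin n) (λ x → ∑-mono (allFin n) (pointwise x)) ⟩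
          ∑ᶠ (λ x → ∑ᶠ (λ y → r x + r y + waste′ x y))
            ≡⟨ ∑-cong (allFin n) inner ⟩
          ∑ᶠ (λ x → n * r x + g + waste x)
            ≡⟨ trans (∑-+ (allFin n) _ waste) (cong (_+ ∑ᶠ waste) (∑-+ (allFin n) _ _)) ⟩
          ∑ᶠ (λ x → n * r x) + ∑ᶠ {n} (λ _ → g) + ∑ᶠ waste
            ≡⟨ cong (_+ ∑ᶠ waste) (cong₂ _+_ (∑-*ˡ (allFin n) n r) (∑ᶠ-const n g)) ⟩
          n * g + n * g + ∑ᶠ waste ∎
          where
          r : Fin n → ℕ
          r x = # (restricting? L x)
          inner : ∀ x → ∑ᶠ (λ y → r x + r y + waste′ x y) ≡ n * r x + g + waste x
          inner x = trans (∑-+ (allFin n) (λ y → r x + r y) (waste′ x))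
            (cong₂ _+_ (trans (∑-+ (allFin n) _ r) (cong (_+ g) (∑ᶠ-const n (r x)))) (∑waste′ x))

    -- `suc N` outweighs the branching over `N` colours and is positive also for `N = 0`; the factor
    -- 2 halves the contribution of a restricting vertex.
    β : ℕ
    β = 2 * suc N

    -- Each hit of a restricting vertex costs a factor N in the number of
    -- partial colourings but uses up one unit of the budget t.
    colorable-count : ∀ k → suc k ≡ 8 * e → ∀ r t L → 4 * e * weight L ≤ t * n →
                      (8 * e) ^ r * ∑ᵛ {n} {r} (λ z → # (colorable? L z)) ≤ β ^ t * (k * n) ^ r
    colorable-count k k+1≡8e zero t L _ = begin
      1 * (1 + 0)      ≤⟨ m^n>0 β t ⟩
      β ^ t            ≡⟨ sym (*-identityʳ _) ⟩
      β ^ t * 1        ∎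
      where open ≤-Reasoning
    -- At least n/(4e) first vertices contribute at most half of `M`, the others at most `M`, so the
    -- average falls by the factor `1 - 1/(8e) = k/(8e)`. Adding `n * M` on both sides avoids
    -- subtraction.
    colorable-count k k+1≡8e (suc r) t L budget = +-cancelʳ-≤ (n * M) _ _ (begin
        8 * e * s * ∑ᵛ {n} {suc r} (λ z → # (colorable? L z)) + n * M
          ≡⟨ cong (λ a → 8 * e * s * a + n * M) (∑ᵛ-suc {n} {r} _) ⟩
        8 * e * s * ∑ᶠ C + n * M
          ≤⟨ +-monoʳ-≤ _ (*-monoˡ-≤ M (many-restricting L)) ⟩
        8 * e * s * ∑ᶠ C + 4 * e * ∑ᶠ ρ * M
          ≡⟨ e₁ e s (∑ᶠ C) (∑ᶠ ρ) M ⟩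
        4 * e * (2 * s * ∑ᶠ C + ∑ᶠ ρ * M)
          ≡⟨ cong (4 * e *_) (sym (trans (∑-+ (allFin n) _ _) (cong₂ _+_ (∑-*ˡ (allFin n) (2 * s) C) (∑-*ʳ (allFin n) M ρ)))) ⟩
        4 * e * ∑ᶠ (λ x → 2 * s * C x + ρ x * M)
          ≤⟨ *-monoʳ-≤ (4 * e) (∑ᶠ-bound each) ⟩
        4 * e * (n * (2 * M))
          ≡⟨ e₂ e n M ⟩
        8 * e * (n * M)
          ≡⟨ cong (_* (n * M)) (sym k+1≡8e) ⟩
        suc k * (n * M)
          ≡⟨ e₃ k n (β ^ t) ((k * n) ^ r) ⟩
        β ^ t * (k * n * (k * n) ^ r) + n * M ∎)
      where
      open ≤-Reasoning
      s = (8 * e) ^ r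
      M = β ^ t * (k * n) ^ r
      C : Fin n → ℕ
      C x = ∑ᵛ {n} {r} (λ z → # (colorable? L (x ∷ z)))
      ρ : Fin n → ℕ
      ρ x = # (restricting? L x)
      e₁ : ∀ e s c g M → 8 * e * s * c + 4 * e * g * M ≡ 4 * e * (2 * s * c + g * M)
      e₁ = solve-∀
      e₂ : ∀ e n M → 4 * e * (n * (2 * M)) ≡ 8 * e * (n * M)
      e₂ = solve-∀
      e₃ : ∀ k n b p → suc k * (n * (b * p)) ≡ b * (k * n * p) + n * (b * p)
      e₃ = solve-∀

      always : ∀ x → s * C x ≤ M
      always x = ≤-trans
        (*-monoʳ-≤ s (∑-mono (vecs n r) (λ z → #-mono (colorable? L (x ∷ z)) (colorable? L z) (Colorable-tail x z))))
        (colorable-count k k+1≡8e r t L budget)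

      branch : ∀ x → Restricting L x → ∀ c →
               β * (s * ∑ᵛ {n} {r} (λ z → # ((L x c Bool.≟ true) ×-dec colorable? (restrict L x c) z))) ≤ M
      branch x res c with L x c in Lxc
      ... | false = subst (_≤ M) (sym (trans (cong (λ a → β * (s * a)) (trans (∑ᵛ-const {n} r 0) (*-zeroʳ (n ^ r)))) (trans (cong (β *_) (*-zeroʳ s)) (*-zeroʳ β)))) z≤n
      ... | true = spend t (begin
          4 * e * weight (restrict L x c) + n                        ≤⟨ +-monoʳ-≤ _ (res c Lxc) ⟩
          4 * e * weight (restrict L x c) + 4 * e * loss L x c       ≡⟨ sym (*-distribˡ-+ (4 * e) _ _) ⟩
          4 * e * (weight (restrict L x c) + loss L x c)             ≡⟨ cong (4 * e *_) (weight-restrict L x c) ⟩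
          4 * e * weight L                                           ≤⟨ budget ⟩
          t * n                                                      ∎)
        where
        spend : ∀ t → 4 * e * weight (restrict L x c) + n ≤ t * n →
                β * (s * ∑ᵛ {n} {r} (λ z → # (yes refl ×-dec colorable? (restrict L x c) z))) ≤ β ^ t * (k * n) ^ r
        -- With no budget left the lists cannot lose the n/(4e) entries that a restricting vertex
        -- demands.
        spend zero    h = contradiction (≤-trans (m≤n+m n _) h) (<⇒≱ 0<n)
        spend (suc t) h = begin
          β * (s * ∑ᵛ {n} {r} (λ z → # (yes refl ×-dec colorable? (restrict L x c) z)))
            ≤⟨ *-monoʳ-≤ β (*-monoʳ-≤ s (∑-mono (vecs n r) (λ z → #-mono (yes refl ×-dec colorable? (restrict L x c) z) (colorable? (restrict L x c) z) proj₂))) ⟩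
          β * (s * ∑ᵛ {n} {r} (λ z → # (colorable? (restrict L x c) z)))
            ≤⟨ *-monoʳ-≤ β (colorable-count k k+1≡8e r t (restrict L x c) (+-cancelʳ-≤ n _ _ (≤-trans h (≤-reflexive (+-comm n (t * n)))))) ⟩
          β * (β ^ t * (k * n) ^ r)
            ≡⟨ sym (*-assoc β (β ^ t) ((k * n) ^ r)) ⟩
          β ^ suc t * (k * n) ^ r ∎

      restricted : ∀ x → Restricting L x → 2 * (s * C x) ≤ M
      restricted x res = *-cancelˡ-≤ (suc N) (begin
        suc N * (2 * (s * C x))       ≡⟨ e₄ (suc N) (s * C x) ⟩
        β * (s * C x)                 ≤⟨ *-monoʳ-≤ β (*-monoʳ-≤ s union) ⟩
        β * (s * ∑ᶠ D)                ≡⟨ trans (sym (*-assoc β s _)) (sym (∑-*ˡ (allFin N) (β * s) D)) ⟩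
        ∑ᶠ (λ c → β * s * D c)        ≤⟨ ∑ᶠ-bound (λ c → subst (_≤ M) (sym (*-assoc β s (D c))) (branch x res c)) ⟩
        N * M                         ≤⟨ *-monoˡ-≤ M (n≤1+n N) ⟩
        suc N * M                     ∎)
        where
        D : Fin N → ℕ
        D c = ∑ᵛ {n} {r} (λ z → # ((L x c Bool.≟ true) ×-dec colorable? (restrict L x c) z))
        e₄ : ∀ a b → a * (2 * b) ≡ 2 * a * b
        e₄ = solve-∀
        union : C x ≤ ∑ᶠ D
        union = begin
          C x
            ≤⟨ ∑-mono (vecs n r) (λ z → #≤ (colorable? L (x ∷ z)) (λ (c , h) →
                 ≤-trans (1≤# ((L x c Bool.≟ true) ×-dec colorable? (restrict L x c) z) h)
                         (≤∑ᶠ (λ c → # ((L x c Bool.≟ true) ×-dec colorable? (restrict L x c) z)) c))) ⟩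
          ∑ᵛ {n} {r} (λ z → ∑ᶠ (λ c → # ((L x c Bool.≟ true) ×-dec colorable? (restrict L x c) z)))
            ≡⟨ ∑-swap (vecs n r) (allFin N) _ ⟩
          ∑ᶠ D ∎

      each : ∀ x → 2 * s * C x + ρ x * M ≤ 2 * M
      each x with restricting? L x
      ... | yes res = begin
        2 * s * C x + 1 * M     ≡⟨ cong₂ _+_ (*-assoc 2 s (C x)) (*-identityˡ M) ⟩
        2 * (s * C x) + M       ≤⟨ +-monoˡ-≤ M (restricted x res) ⟩
        M + M                   ≡⟨ cong (M +_) (sym (+-identityʳ M)) ⟩
        2 * M                   ∎
      ... | no _ = begin
        2 * s * C x + 0         ≡⟨ trans (+-identityʳ _) (*-assoc 2 s (C x)) ⟩
        2 * (s * C x)           ≤⟨ *-monoʳ-≤ 2 (always x) ⟩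
        2 * M                   ∎

-- Exponential decay against powers of two

^-distribʳ-* : ∀ a b r → (a * b) ^ r ≡ a ^ r * b ^ r
^-distribʳ-* a b zero    = refl
^-distribʳ-* a b (suc r) = trans (cong (a * b *_) (^-distribʳ-* a b r)) (e a b (a ^ r) (b ^ r))
  where
  e : ∀ a b c d → a * b * (c * d) ≡ a * c * (b * d)
  e = solve-∀

n≤2^n : ∀ n → n ≤ 2 ^ n
n≤2^n zero    = z≤n
n≤2^n (suc n) = begin
  suc n                ≤⟨ +-mono-≤ (m^n>0 2 n) (n≤2^n n) ⟩
  2 ^ n + 2 ^ n        ≡⟨ cong (2 ^ n +_) (sym (+-identityʳ _)) ⟩
  2 * 2 ^ n            ∎
  where open ≤-Reasoning

-- Bernoulli's inequality (1 + c/x)^w ≥ 1 + wc/x, cleared of denominators.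
bernoulli : ∀ x c w → x ^ w * (x + w * c) ≤ x * (x + c) ^ w
bernoulli x c zero    = ≤-reflexive (e x)
  where
  e : ∀ x → 1 * (x + 0) ≡ x * 1
  e = solve-∀
bernoulli x c (suc w) = begin
  x * x ^ w * (x + (c + w * c))                  ≤⟨ m≤m+n _ (x ^ w * (c * (w * c))) ⟩
  x * x ^ w * (x + (c + w * c)) + x ^ w * (c * (w * c))
                                                 ≡⟨ e₁ x (x ^ w) c (w * c) ⟩
  (x + c) * (x ^ w * (x + w * c))                ≤⟨ *-monoʳ-≤ (x + c) (bernoulli x c w) ⟩
  (x + c) * (x * (x + c) ^ w)                    ≡⟨ e₂ (x + c) x ((x + c) ^ w) ⟩
  x * ((x + c) * (x + c) ^ w)                    ∎
  where
  open ≤-Reasoning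
  e₁ : ∀ x p c d → x * p * (x + (c + d)) + p * (c * d) ≡ (x + c) * (p * (x + d))
  e₁ = solve-∀
  e₂ : ∀ a b c → a * (b * c) ≡ b * (a * c)
  e₂ = solve-∀

2κ^≤[1+κ]^ : ∀ κ → 2 * κ ^ suc κ ≤ suc κ ^ suc κ
2κ^≤[1+κ]^ zero      = z≤n
2κ^≤[1+κ]^ κ@(suc _) = *-cancelˡ-≤ κ (begin
  κ * (2 * κ ^ suc κ)            ≡⟨ e κ (κ ^ suc κ) ⟩
  κ ^ suc κ * (κ + κ)            ≤⟨ *-monoʳ-≤ (κ ^ suc κ) (+-monoʳ-≤ κ (≤-trans (n≤1+n κ) (≤-reflexive (sym (*-identityʳ (suc κ)))))) ⟩
  κ ^ suc κ * (κ + suc κ * 1)    ≤⟨ bernoulli κ 1 (suc κ) ⟩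
  κ * (κ + 1) ^ suc κ            ≡⟨ cong (λ a → κ * a ^ suc κ) (+-comm κ 1) ⟩
  κ * suc κ ^ suc κ              ∎)
  where
  open ≤-Reasoning
  e : ∀ a b → a * (2 * b) ≡ b * (a + a)
  e = solve-∀

-- Every `κ + 1` factors `κ / (κ + 1)` amount to at most one half. Both the colouring count and the
-- degree estimate turn their decay into powers of two this way.
2^y*κ^≤[1+κ]^ : ∀ κ y → 2 ^ y * κ ^ (suc κ * y) ≤ suc κ ^ (suc κ * y)
2^y*κ^≤[1+κ]^ κ y = begin
  2 ^ y * κ ^ (suc κ * y)        ≡⟨ cong (2 ^ y *_) (sym (^-*-assoc κ (suc κ) y)) ⟩
  2 ^ y * (κ ^ suc κ) ^ y        ≡⟨ sym (^-distribʳ-* 2 (κ ^ suc κ) y) ⟩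
  (2 * κ ^ suc κ) ^ y            ≤⟨ ^-monoˡ-≤ y (2κ^≤[1+κ]^ κ) ⟩
  (suc κ ^ suc κ) ^ y            ≡⟨ ^-*-assoc (suc κ) (suc κ) y ⟩
  suc κ ^ (suc κ * y)            ∎
  where open ≤-Reasoning

module _ {N} (G : Graph n) (F : Graph N) {e} (0<e : 0 ℕ.< e) (0<n : 0 ℕ.< n)
         (far : ∀ φ → n * n ≤ e * ∑ᶠ (λ x → ∑ᶠ (λ y → ind (violated G F φ x y)))) where
  open ListColoring G F
  open Sampling 0<e 0<n far

  -- Full lists weigh `n * N`, which gives the budget `t = 4 * e * N`. Over `8 * e * ℓ` draws the
  -- decay is at most 2^(-ℓ), and this outweighs `3 * β ^ t` because 3 ≤ 2² and β ≤ 2^β.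
  few-colorable : ∀ ℓ → 2 + β * (4 * e * N) ≤ ℓ →
                  3 * ∑ᵛ {n} {8 * e * ℓ} (λ z → # (colorable? (λ _ _ → true) z)) ≤ n ^ (8 * e * ℓ)
  few-colorable ℓ ℓ-large = go (pred (8 * e)) (suc-pred (8 * e) {{m*n≢0 8 e {{_}} {{>-nonZero 0<e}}}})
    where
    open ≤-Reasoning
    t = 4 * e * N
    q = 8 * e * ℓ
    cnt = ∑ᵛ {n} {q} (λ z → # (colorable? (λ _ _ → true) z))
    budget : 4 * e * weight (λ _ _ → true) ≤ t * n
    budget = ≤-reflexive (trans (cong (4 * e *_) (trans (∑-cong (allFin n) (λ _ → trans (∑ᶠ-const N 1) (*-identityʳ N))) (∑ᶠ-const n N))) (e₁ (4 * e) n N))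
      where
      e₁ : ∀ a n N → a * (n * N) ≡ a * N * n
      e₁ = solve-∀
    3β^t≤2^ℓ : 3 * β ^ t ≤ 2 ^ ℓ
    3β^t≤2^ℓ = begin
      3 * β ^ t              ≤⟨ *-mono-≤ {3} {4} (n≤1+n 3) (^-monoˡ-≤ t (n≤2^n β)) ⟩
      4 * (2 ^ β) ^ t        ≡⟨ cong (4 *_) (^-*-assoc 2 β t) ⟩
      2 ^ 2 * 2 ^ (β * t)    ≡⟨ sym (^-distribˡ-+-* 2 2 (β * t)) ⟩
      2 ^ (2 + β * t)        ≤⟨ ^-monoʳ-≤ 2 ℓ-large ⟩
      2 ^ ℓ                  ∎
    go : ∀ k → suc k ≡ 8 * e → 3 * cnt ≤ n ^ q
    -- `8 * e` is at least 8, so `k` is positive and its powers can be cancelled.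
    go zero        k+1≡8e = contradiction (≤-trans (*-monoʳ-≤ 8 0<e) (≤-reflexive (sym k+1≡8e))) λ { (s≤s ()) }
    go k@(suc _) k+1≡8e = *-cancelˡ-≤ (k ^ q) {{m^n≢0 k q}} (*-cancelˡ-≤ (β ^ t) {{m^n≢0 β t}} (begin
      β ^ t * (k ^ q * (3 * cnt))       ≡⟨ e₁ (β ^ t) (k ^ q) cnt ⟩
      3 * β ^ t * k ^ q * cnt           ≤⟨ *-monoˡ-≤ cnt (*-monoˡ-≤ (k ^ q) 3β^t≤2^ℓ) ⟩
      2 ^ ℓ * k ^ q * cnt               ≤⟨ *-monoˡ-≤ cnt (subst (λ m → 2 ^ ℓ * k ^ (m * ℓ) ≤ m ^ (m * ℓ)) k+1≡8e (2^y*κ^≤[1+κ]^ k ℓ)) ⟩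
      (8 * e) ^ q * cnt                 ≤⟨ colorable-count k k+1≡8e q t (λ _ _ → true) budget ⟩
      β ^ t * (k * n) ^ q               ≡⟨ cong (β ^ t *_) (^-distribʳ-* k n q) ⟩
      β ^ t * (k ^ q * n ^ q)           ∎))
      where
      e₁ : ∀ a b c → a * (b * (3 * c)) ≡ 3 * a * b * c
      e₁ = solve-∀

-- A Chernoff bound for degrees in a sample

∑ᶠ-suc : ∀ (f : Fin (suc n) → ℕ) → ∑ᶠ f ≡ f Fin.zero + ∑ᶠ (f ∘ Fin.suc)
∑ᶠ-suc f = cong (λ xs → f Fin.zero + sum xs) (trans (map-tabulate Fin.suc f) (sym (map-tabulate id (f ∘ Fin.suc))))

module Degrees (G : Graph n) where

  degᵛ : ∀ {q} → Fin n → Vec (Fin n) q → ℕ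
  degᵛ x []      = 0
  degᵛ x (y ∷ z) = ind (adj G x y) + degᵛ x z

  degᵛ-∑ : ∀ {q} x (z : Vec (Fin n) q) → ∑ᶠ (λ j → ind (adj G x (lookup z j))) ≡ degᵛ x z
  degᵛ-∑ x []      = refl
  degᵛ-∑ x (y ∷ z) = trans (∑ᶠ-suc (λ j → ind (adj G x (lookup (y ∷ z) j)))) (cong (ind (adj G x y) +_) (degᵛ-∑ x z))

  module Weights (k′ : ℕ) where
    k = suc k′

    -- The exponential weight that is `1 - 1/k` on neighbours and 1 elsewhere, made integral by the
    -- factor `k`.
    ω : Fin n → Fin n → ℕ
    ω x y = k′ + ind (not (adj G x y))

    ωᵛ : ∀ {q} → Fin n → Vec (Fin n) q → ℕ
    ωᵛ x []      = 1
    ωᵛ x (y ∷ z) = ω x y * ωᵛ x z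

    ωᵛ-degᵛ : ∀ {q} x (z : Vec (Fin n) q) → ωᵛ x z * k ^ degᵛ x z ≡ k ^ q * k′ ^ degᵛ x z
    ωᵛ-degᵛ x []      = refl
    ωᵛ-degᵛ {suc q} x (y ∷ z) with adj G x y
    ... | true  = trans (e₁ k′ (ωᵛ x z) (k ^ degᵛ x z)) (trans (cong (suc k′ * k′ *_) (ωᵛ-degᵛ x z)) (e₂ k′ (k ^ q) (k′ ^ degᵛ x z)))
      where
      e₁ : ∀ a w d → (a + 0) * w * (suc a * d) ≡ suc a * a * (w * d)
      e₁ = solve-∀
      e₂ : ∀ a p d → suc a * a * (p * d) ≡ suc a * p * (a * d)
      e₂ = solve-∀
    ... | false = trans (e₁ k′ (ωᵛ x z) (k ^ degᵛ x z)) (trans (cong (suc k′ *_) (ωᵛ-degᵛ x z)) (sym (*-assoc k (k ^ q) _)))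
      where
      e₁ : ∀ a w d → (a + 1) * w * d ≡ suc a * (w * d)
      e₁ = solve-∀

    ωᵛ-large : ∀ {q} x (z : Vec (Fin n) q) D → degᵛ x z ≤ D → k′ ^ D * k ^ q ≤ ωᵛ x z * k ^ D
    ωᵛ-large {q} x z D d≤D = begin
      k′ ^ D * k ^ q                      ≡⟨ cong (λ a → k′ ^ a * k ^ q) (sym d+r≡D) ⟩
      k′ ^ (d + r) * k ^ q                ≡⟨ cong (_* k ^ q) (^-distribˡ-+-* k′ d r) ⟩
      k′ ^ d * k′ ^ r * k ^ q             ≡⟨ e₁ (k′ ^ d) (k′ ^ r) (k ^ q) ⟩
      k ^ q * k′ ^ d * k′ ^ r             ≡⟨ cong (_* k′ ^ r) (sym (ωᵛ-degᵛ x z)) ⟩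
      ωᵛ x z * k ^ d * k′ ^ r             ≤⟨ *-monoʳ-≤ (ωᵛ x z * k ^ d) (^-monoˡ-≤ r (n≤1+n k′)) ⟩
      ωᵛ x z * k ^ d * k ^ r              ≡⟨ *-assoc (ωᵛ x z) _ _ ⟩
      ωᵛ x z * (k ^ d * k ^ r)            ≡⟨ cong (ωᵛ x z *_) (sym (^-distribˡ-+-* k d r)) ⟩
      ωᵛ x z * k ^ (d + r)                ≡⟨ cong (λ a → ωᵛ x z * k ^ a) d+r≡D ⟩
      ωᵛ x z * k ^ D                      ∎
      where
      open ≤-Reasoning
      d = degᵛ x z
      r = D ∸ d
      d+r≡D = m+[n∸m]≡n d≤D
      e₁ : ∀ a b c → a * b * c ≡ c * a * b
      e₁ = solve-∀

    ωᵛ-insertAt : ∀ {q} x (z : Vec (Fin n) q) i y → ωᵛ x (insertAt z i y) ≡ ω x y * ωᵛ x z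
    ωᵛ-insertAt x z       Fin.zero    y = refl
    ωᵛ-insertAt x (u ∷ z) (Fin.suc i) y = trans (cong (ω x u *_) (ωᵛ-insertAt x z i y)) (e₁ (ω x u) (ω x y) _)
      where
      e₁ : ∀ a b c → a * (b * c) ≡ b * (a * c)
      e₁ = solve-∀

    ∑ωᵛ : ∀ q x → ∑ᵛ {n} {q} (ωᵛ x) ≡ ∑ᶠ (ω x) ^ q
    ∑ωᵛ zero    x = refl
    ∑ωᵛ (suc q) x = begin
      ∑ᵛ {n} {suc q} (ωᵛ x)                      ≡⟨ ∑ᵛ-suc {n} {q} (ωᵛ x) ⟩
      ∑ᶠ (λ y → ∑ᵛ {n} {q} (λ z → ω x y * ωᵛ x z))  ≡⟨ ∑-cong (allFin n) (λ y → ∑-*ˡ (vecs n q) (ω x y) (ωᵛ x)) ⟩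
      ∑ᶠ (λ y → ω x y * ∑ᵛ {n} {q} (ωᵛ x))       ≡⟨ ∑-*ʳ (allFin n) _ (ω x) ⟩
      ∑ᶠ (ω x) * ∑ᵛ {n} {q} (ωᵛ x)               ≡⟨ cong (∑ᶠ (ω x) *_) (∑ωᵛ q x) ⟩
      ∑ᶠ (ω x) * ∑ᶠ (ω x) ^ q                    ∎
      where open ≡-Reasoning

    ω-deg : ∀ x → ∑ᶠ (ω x) + deg G x ≡ k * n
    ω-deg x = begin
      ∑ᶠ (ω x) + deg G x                            ≡⟨ sym (∑-+ (allFin n) (ω x) (λ y → ind (adj G x y))) ⟩
      ∑ᶠ (λ y → ω x y + ind (adj G x y))            ≡⟨ ∑-cong (allFin n) (λ y → e₁ (adj G x y)) ⟩
      ∑ᶠ {n} (λ _ → k)                              ≡⟨ ∑ᶠ-const n k ⟩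
      n * k                                         ≡⟨ *-comm n k ⟩
      k * n                                         ∎
      where
      open ≡-Reasoning
      e₁ : ∀ b → k′ + ind (not b) + ind b ≡ k
      e₁ true  = trans (cong (_+ 1) (+-identityʳ k′)) (+-comm k′ 1)
      e₁ false = trans (+-identityʳ _) (+-comm k′ 1)

    -- Markov's inequality for the exponential moment ωᵛ.
    low-degree-count : ∀ p (i : Fin (suc p)) D →
      k′ ^ D * k ^ suc p * ∑ᵛ {n} {suc p} (λ z → # (degᵛ (lookup z i) z <? D)) ≤ k ^ D * ∑ᶠ (λ x → k * ∑ᶠ (ω x) ^ p)
    low-degree-count p i D = begin
      A * ∑ᵛ {n} {suc p} (λ z → # (degᵛ (lookup z i) z <? D))     ≡⟨ sym (∑-*ˡ (vecs n (suc p)) A _) ⟩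
      ∑ᵛ {n} {suc p} (λ z → A * # (degᵛ (lookup z i) z <? D))     ≤⟨ ∑-mono (vecs n (suc p)) markov ⟩
      ∑ᵛ {n} {suc p} (λ z → k ^ D * ωᵛ (lookup z i) z)            ≡⟨ ∑-*ˡ (vecs n (suc p)) (k ^ D) _ ⟩
      k ^ D * ∑ᵛ {n} {suc p} (λ z → ωᵛ (lookup z i) z)            ≡⟨ cong (k ^ D *_) (∑ᵛ-insertAt {n} {p} (λ z → ωᵛ (lookup z i) z) i) ⟩
      k ^ D * ∑ᶠ (λ x → ∑ᵛ {n} {p} (λ z → ωᵛ (lookup (insertAt z i x) i) (insertAt z i x)))
                                                                  ≡⟨ cong (k ^ D *_) (∑-cong (allFin n) inner) ⟩
      k ^ D * ∑ᶠ (λ x → k * ∑ᶠ (ω x) ^ p)                         ∎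
      where
      open ≤-Reasoning
      A = k′ ^ D * k ^ suc p
      markov : ∀ z → A * # (degᵛ (lookup z i) z <? D) ≤ k ^ D * ωᵛ (lookup z i) z
      markov z with degᵛ (lookup z i) z <? D
      ... | yes d<D = subst₂ _≤_ (sym (*-identityʳ A)) (*-comm _ (k ^ D)) (ωᵛ-large (lookup z i) z D (<⇒≤ d<D))
      ... | no  _   = subst (_≤ k ^ D * ωᵛ (lookup z i) z) (sym (*-zeroʳ A)) z≤n
      -- Position `i` holds `x` itself, which is not its own neighbour and so has weight `k`; the
      -- other `p` entries are independent.
      inner : ∀ x → ∑ᵛ {n} {p} (λ z → ωᵛ (lookup (insertAt z i x) i) (insertAt z i x)) ≡ k * ∑ᶠ (ω x) ^ p
      inner x = trans (∑-cong (vecs n p) step) (trans (∑-*ˡ (vecs n p) k (ωᵛ x)) (cong (k *_) (∑ωᵛ p x)))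
        where
        step : ∀ z → ωᵛ (lookup (insertAt z i x) i) (insertAt z i x) ≡ k * ωᵛ x z
        step z rewrite insertAt-lookup z i x | ωᵛ-insertAt x z i x | adj-irr G x | +-comm k′ 1 = refl

-- Bernoulli for `(1 - 1/k) ^ B`, with `s` standing for `k - B`; each induction step moves one unit
-- from `B` to `s`.
[1-1/k]^ : ∀ k′ B s → B + s ≡ suc k′ → suc k′ ^ B * s ≤ suc k′ * k′ ^ B
[1-1/k]^ k′ zero    s eq = ≤-reflexive (trans (*-identityˡ s) (trans eq (sym (*-identityʳ _))))
[1-1/k]^ k′ (suc B) s eq = begin
  suc k′ * suc k′ ^ B * s          ≡⟨ cong (λ a → suc a * suc k′ ^ B * s) k′≡ ⟩
  suc (B + s) * suc k′ ^ B * s     ≤⟨ m≤m+n _ (B * suc k′ ^ B) ⟩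
  suc (B + s) * suc k′ ^ B * s + B * suc k′ ^ B
                                   ≡⟨ e₁ B s (suc k′ ^ B) ⟩
  (B + s) * (suc k′ ^ B * suc s)   ≡⟨ cong (_* (suc k′ ^ B * suc s)) (sym k′≡) ⟩
  k′ * (suc k′ ^ B * suc s)        ≤⟨ *-monoʳ-≤ k′ ([1-1/k]^ k′ B (suc s) (trans (+-suc B s) eq)) ⟩
  k′ * (suc k′ * k′ ^ B)           ≡⟨ e₂ k′ (k′ ^ B) ⟩
  suc k′ * (k′ * k′ ^ B)           ∎
  where
  open ≤-Reasoning
  k′≡ : k′ ≡ B + s
  k′≡ = sym (suc-injective eq)
  e₁ : ∀ B s p → suc (B + s) * p * s + B * p ≡ (B + s) * (p * suc s)
  e₁ = solve-∀
  e₂ : ∀ k p → k * (suc k * p) ≡ suc k * (k * p)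
  e₂ = solve-∀

-- With success probability at least c/W = (B+1)/W and threshold B/W, the weights
-- k and k - 1 shrink the exponential moment provided k > B(B+1).
module Rate (B : ℕ) where
  k′ k κ c : ℕ
  k′ = suc B * suc B
  k  = suc k′
  κ  = k * k
  c  = suc B

  -- Draws are grouped in blocks of `W` with threshold `B` per block, and `u / W` bounds the mean
  -- weight of a draw. The two Bernoulli estimates contribute `k + c` and `s = k - B`, whose product
  -- exceeds `k * k` by `k - B * (B + 1) = B + 2`.
  moment-rate : ∀ W u → 0 ℕ.< u → u + c ≡ W * k →
                suc κ * (k ^ B * u ^ W) ≤ κ * (k′ ^ B * (W * k) ^ W)
  moment-rate W u 0<u u+c≡Wk = begin
    suc κ * (k ^ B * u ^ W)                     ≤⟨ *-monoˡ-≤ (k ^ B * u ^ W) κ<[k+c]s ⟩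
    (k + c) * s * (k ^ B * u ^ W)               ≡⟨ e₁ (k + c) s (k ^ B) (u ^ W) ⟩
    k ^ B * s * (u ^ W * (k + c))               ≤⟨ *-mono-≤ ([1-1/k]^ k′ B s B+s≡k) above ⟩
    k * k′ ^ B * (k * (u + c) ^ W)              ≡⟨ e₂ k (k′ ^ B) _ ⟩
    κ * (k′ ^ B * (u + c) ^ W)                  ≡⟨ cong (λ a → κ * (k′ ^ B * a ^ W)) u+c≡Wk ⟩
    κ * (k′ ^ B * (W * k) ^ W)                  ∎
    where
    open ≤-Reasoning
    s = suc (suc (B * B + B))
    e₁ : ∀ a b c d → a * b * (c * d) ≡ c * b * (d * a)
    e₁ = solve-∀
    e₂ : ∀ k a b → k * a * (k * b) ≡ k * k * (a * b)
    e₂ = solve-∀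
    B+s≡k : B + s ≡ k
    B+s≡k = e B
      where
      e : ∀ B → B + (suc (suc (B * B + B))) ≡ suc (suc B * suc B)
      e = solve-∀
    κ<[k+c]s : κ ℕ.< (k + c) * s
    κ<[k+c]s = ≤-trans (m≤m+n (suc κ) (suc B)) (≤-reflexive (e B))
      where
      e : ∀ B → suc (suc (suc B * suc B) * suc (suc B * suc B)) + suc B
              ≡ (suc (suc B * suc B) + suc B) * suc (suc (B * B + B))
      e = solve-∀
    -- Since `u ≤ W * k`, the gain `W * c / u` in Bernoulli's inequality is at least `c / k`.
    above : u ^ W * (k + c) ≤ k * (u + c) ^ W
    above = *-cancelˡ-≤ u {{>-nonZero 0<u}} (begin
      u * (u ^ W * (k + c))              ≡⟨ e₃ u (u ^ W) k c ⟩
      u ^ W * (k * u + u * c)            ≤⟨ *-monoʳ-≤ (u ^ W) (+-monoʳ-≤ (k * u) (*-monoˡ-≤ c (≤-trans (m≤m+n u c) (≤-reflexive u+c≡Wk)))) ⟩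
      u ^ W * (k * u + W * k * c)        ≡⟨ e₄ (u ^ W) k u W c ⟩
      k * (u ^ W * (u + W * c))          ≤⟨ *-monoʳ-≤ k (bernoulli u c W) ⟩
      k * (u * (u + c) ^ W)              ≡⟨ e₅ k u _ ⟩
      u * (k * (u + c) ^ W)              ∎)
      where
      e₃ : ∀ u p k c → u * (p * (k + c)) ≡ p * (k * u + u * c)
      e₃ = solve-∀
      e₄ : ∀ p k u W c → p * (k * u + W * k * c) ≡ k * (p * (u + W * c))
      e₄ = solve-∀
      e₅ : ∀ k u p → k * (u * p) ≡ u * (k * p)
      e₅ = solve-∀

  module _ (W : ℕ) .{{_ : NonZero W}} (G : Graph n) (0<n : 0 ℕ.< n) (dense : ∀ x → c * n ≤ W * deg G x) where
    open Degrees G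
    open Weights k′ hiding (k)

    private
      u : ℕ
      u = W * k ∸ c

      c≤W : c ≤ W
      c≤W = *-cancelʳ-≤ c W n {{>-nonZero 0<n}} (≤-trans (dense x₀) (*-monoʳ-≤ W deg≤n))
        where
        x₀ = Fin.fromℕ< 0<n
        deg≤n : deg G x₀ ≤ n
        deg≤n = ≤-trans (∑ᶠ-bound (λ y → ind≤1 (adj G x₀ y))) (≤-reflexive (*-identityʳ n))

      2c≤Wk : 2 * c ≤ W * k
      2c≤Wk = ≤-trans (≤-reflexive (*-comm 2 c)) (*-mono-≤ c≤W (s≤s (s≤s z≤n)))

      u+c≡Wk : u + c ≡ W * k
      u+c≡Wk = m∸n+n≡m (≤-trans (m≤m+n c (c + 0)) 2c≤Wk)

      c≤u : c ≤ u
      c≤u = +-cancelʳ-≤ c c u (≤-trans (≤-reflexive (cong (c +_) (sym (+-identityʳ c)))) (≤-trans 2c≤Wk (≤-reflexive (sym u+c≡Wk))))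

      ∑ω-small : ∀ x → W * ∑ᶠ (ω x) ≤ u * n
      ∑ω-small x = +-cancelʳ-≤ (c * n) _ _ (begin
        W * ∑ᶠ (ω x) + c * n           ≤⟨ +-monoʳ-≤ _ (dense x) ⟩
        W * ∑ᶠ (ω x) + W * deg G x     ≡⟨ sym (*-distribˡ-+ W _ _) ⟩
        W * (∑ᶠ (ω x) + deg G x)       ≡⟨ cong (W *_) (ω-deg x) ⟩
        W * (k * n)                    ≡⟨ sym (*-assoc W k n) ⟩
        W * k * n                      ≡⟨ cong (_* n) (sym u+c≡Wk) ⟩
        (u + c) * n                    ≡⟨ *-distribʳ-+ n u c ⟩
        u * n + c * n                  ∎)
        where open ≤-Reasoning

      -- The entry fixed as `x` has weight `k` where the mean is bounded by `u / W`; as `c ≤ u`,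
      -- this is at most twice as much, hence the factor 2.
      moment : ∀ p → W ^ suc p * ∑ᶠ (λ x → k * ∑ᶠ (ω x) ^ p) ≤ 2 * (u * n) ^ suc p
      moment p = begin
        W ^ suc p * ∑ᶠ (λ x → k * ∑ᶠ (ω x) ^ p)            ≡⟨ sym (∑-*ˡ (allFin n) (W ^ suc p) _) ⟩
        ∑ᶠ (λ x → W * W ^ p * (k * ∑ᶠ (ω x) ^ p))          ≤⟨ ∑ᶠ-bound each ⟩
        n * (2 * u * (u * n) ^ p)                          ≡⟨ e₁ n u ((u * n) ^ p) ⟩
        2 * (u * n * (u * n) ^ p)                          ∎
        where
        open ≤-Reasoning
        e₁ : ∀ n u p → n * (2 * u * p) ≡ 2 * (u * n * p)
        e₁ = solve-∀
        e₂ : ∀ W w k s → W * w * (k * s) ≡ W * k * (w * s)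
        e₂ = solve-∀
        Wk≤2u : W * k ≤ 2 * u
        Wk≤2u = begin
          W * k      ≡⟨ sym u+c≡Wk ⟩
          u + c      ≤⟨ +-monoʳ-≤ u c≤u ⟩
          u + u      ≡⟨ cong (u +_) (sym (+-identityʳ u)) ⟩
          2 * u      ∎
        each : ∀ x → W * W ^ p * (k * ∑ᶠ (ω x) ^ p) ≤ 2 * u * (u * n) ^ p
        each x = begin
          W * W ^ p * (k * ∑ᶠ (ω x) ^ p)       ≡⟨ e₂ W (W ^ p) k _ ⟩
          W * k * (W ^ p * ∑ᶠ (ω x) ^ p)       ≡⟨ cong (W * k *_) (sym (^-distribʳ-* W (∑ᶠ (ω x)) p)) ⟩
          W * k * (W * ∑ᶠ (ω x)) ^ p           ≤⟨ *-mono-≤ Wk≤2u (^-monoˡ-≤ p (∑ω-small x)) ⟩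
          2 * u * (u * n) ^ p                  ∎

    -- The sequence consists of `suc κ * y` blocks of `W` draws. By `moment-rate` each contributes a
    -- factor of at most `κ / (κ + 1)` to Markov's inequality, together 2^(-y).
    chernoff : ∀ q y → q ≡ W * (suc κ * y) → ∀ (i : Fin q) →
               2 ^ y * ∑ᵛ {n} {q} (λ z → # (degᵛ (lookup z i) z <? B * (suc κ * y))) ≤ 2 * n ^ q
    chernoff q@(suc p) y q≡ i =
      *-cancelˡ-≤ (κ ^ q′) {{m^n≢0 κ q′}} (*-cancelˡ-≤ (P ^ q′) {{m^n≢0 P q′ {{P≢0}}}} (begin
        P ^ q′ * (κ ^ q′ * (2 ^ y * bad))          ≡⟨ e₁ (P ^ q′) (κ ^ q′) (2 ^ y) bad ⟩
        2 ^ y * κ ^ q′ * (P ^ q′ * bad)            ≤⟨ *-monoˡ-≤ (P ^ q′ * bad) (2^y*κ^≤[1+κ]^ κ y) ⟩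
        suc κ ^ q′ * (P ^ q′ * bad)                ≤⟨ *-monoʳ-≤ (suc κ ^ q′) P^bad ⟩
        suc κ ^ q′ * (2 * R ^ q′ * n ^ q)          ≡⟨ e₂ (suc κ ^ q′) (R ^ q′) (n ^ q) ⟩
        suc κ ^ q′ * R ^ q′ * (2 * n ^ q)          ≡⟨ cong (_* (2 * n ^ q)) (sym (^-distribʳ-* (suc κ) R q′)) ⟩
        (suc κ * R) ^ q′ * (2 * n ^ q)             ≤⟨ *-monoˡ-≤ (2 * n ^ q) (^-monoˡ-≤ q′ (moment-rate W u (≤-trans z<s c≤u) u+c≡Wk)) ⟩
        (κ * P) ^ q′ * (2 * n ^ q)                 ≡⟨ cong (_* (2 * n ^ q)) (^-distribʳ-* κ P q′) ⟩
        κ ^ q′ * P ^ q′ * (2 * n ^ q)              ≡⟨ e₃ (κ ^ q′) (P ^ q′) (2 * n ^ q) ⟩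
        P ^ q′ * (κ ^ q′ * (2 * n ^ q))            ∎))
      where
      open ≤-Reasoning
      q′ = suc κ * y
      D = B * q′
      P = k′ ^ B * (W * k) ^ W
      R = k ^ B * u ^ W
      bad = ∑ᵛ {n} {q} (λ z → # (degᵛ (lookup z i) z <? D))
      P≢0 : NonZero P
      P≢0 = m*n≢0 (k′ ^ B) ((W * k) ^ W) {{m^n≢0 k′ B}} {{m^n≢0 (W * k) W {{m*n≢0 W k}}}}
      e₁ : ∀ a b c d → a * (b * (c * d)) ≡ c * b * (a * d)
      e₁ = solve-∀
      e₂ : ∀ a b c → a * (2 * b * c) ≡ a * b * (2 * c)
      e₂ = solve-∀
      e₃ : ∀ a b c → a * b * c ≡ b * (a * c)
      e₃ = solve-∀
      pow : ∀ a b → (a ^ B * b ^ W) ^ q′ ≡ a ^ D * b ^ q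
      pow a b = trans (^-distribʳ-* (a ^ B) (b ^ W) q′)
        (cong₂ _*_ (^-*-assoc a B q′) (trans (^-*-assoc b W q′) (cong (b ^_) (sym q≡))))
      P^bad : P ^ q′ * bad ≤ 2 * R ^ q′ * n ^ q
      P^bad = begin
        P ^ q′ * bad                                     ≡⟨ cong (_* bad) (trans (pow k′ (W * k)) (cong (k′ ^ D *_) (^-distribʳ-* W k q))) ⟩
        k′ ^ D * (W ^ q * k ^ q) * bad                   ≡⟨ e₄ (k′ ^ D) (W ^ q) (k ^ q) bad ⟩
        W ^ q * (k′ ^ D * k ^ q * bad)                   ≤⟨ *-monoʳ-≤ (W ^ q) (low-degree-count p i D) ⟩
        W ^ q * (k ^ D * ∑ᶠ (λ x → k * ∑ᶠ (ω x) ^ p))    ≡⟨ e₅ (W ^ q) (k ^ D) _ ⟩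
        k ^ D * (W ^ q * ∑ᶠ (λ x → k * ∑ᶠ (ω x) ^ p))    ≤⟨ *-monoʳ-≤ (k ^ D) (moment p) ⟩
        k ^ D * (2 * (u * n) ^ q)                        ≡⟨ cong (λ a → k ^ D * (2 * a)) (^-distribʳ-* u n q) ⟩
        k ^ D * (2 * (u ^ q * n ^ q))                    ≡⟨ e₆ (k ^ D) (u ^ q) (n ^ q) ⟩
        2 * (k ^ D * u ^ q) * n ^ q                      ≡⟨ cong (λ a → 2 * a * n ^ q) (sym (pow k u)) ⟩
        2 * R ^ q′ * n ^ q                               ∎
        where
        e₄ : ∀ a b c d → a * (b * c) * d ≡ b * (a * c * d)
        e₄ = solve-∀
        e₅ : ∀ a b c → a * (b * c) ≡ b * (a * c)
        e₅ = solve-∀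
        e₆ : ∀ a b c → a * (2 * (b * c)) ≡ 2 * (a * b) * c
        e₆ = solve-∀

    -- Union bound over the `q` positions: `q` is linear in `m`, while `chernoff` with `y = 2 * m`
    -- gains at least `m * m`.
    few-low-degree : ∀ q m → q ≡ W * (suc κ * (2 * m)) → 12 * (W * suc κ) ≤ m → 0 ℕ.< q →
      3 * ∑ᵛ {n} {q} (λ z → ∑ᶠ (λ i → # (W * deg (pullback G z) i <? B * q))) ≤ n ^ q
    few-low-degree q m q≡ m-large 0<q = *-cancelˡ-≤ (2 * q) {{m*n≢0 2 q {{_}} {{>-nonZero 0<q}}}} (begin
        2 * q * (3 * ∑ᵛ {n} {q} (λ z → ∑ᶠ (λ i → # (W * deg (pullback G z) i <? B * q))))
          ≡⟨ e₁ q _ ⟩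
        6 * q * ∑ᵛ {n} {q} (λ z → ∑ᶠ (λ i → # (W * deg (pullback G z) i <? B * q)))
          ≤⟨ *-mono-≤ 6q≤2^y (∑-mono (vecs n q) (λ z → ∑-mono (allFin q) (λ i → scaled z i))) ⟩
        2 ^ y * ∑ᵛ {n} {q} (λ z → ∑ᶠ (λ i → low i z))
          ≡⟨ cong (2 ^ y *_) (∑-swap (vecs n q) (allFin q) (λ z i → low i z)) ⟩
        2 ^ y * ∑ᶠ (λ i → ∑ᵛ {n} {q} (low i))
          ≡⟨ sym (∑-*ˡ (allFin q) (2 ^ y) _) ⟩
        ∑ᶠ (λ i → 2 ^ y * ∑ᵛ {n} {q} (low i))
          ≤⟨ ∑ᶠ-bound (chernoff q y q≡) ⟩
        q * (2 * n ^ q)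
          ≡⟨ e₂ q (n ^ q) ⟩
        2 * q * n ^ q ∎)
      where
      open ≤-Reasoning
      y = 2 * m
      D = B * (suc κ * y)
      low : Fin q → Vec (Fin n) q → ℕ
      low i z = # (degᵛ (lookup z i) z <? D)
      e₁ : ∀ q a → 2 * q * (3 * a) ≡ 6 * q * a
      e₁ = solve-∀
      e₂ : ∀ q a → q * (2 * a) ≡ 2 * q * a
      e₂ = solve-∀
      scaled : ∀ z i → # (W * deg (pullback G z) i <? B * q) ≤ low i z
      scaled z i = #-mono (W * deg (pullback G z) i <? B * q) (degᵛ (lookup z i) z <? D) λ lt →
        subst (ℕ._< D) (degᵛ-∑ (lookup z i) z)
          (*-cancelˡ-< W _ _ (subst (W * deg (pullback G z) i ℕ.<_) (trans (cong (B *_) q≡) (e B W (suc κ * y))) lt))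
        where
        e : ∀ B W a → B * (W * a) ≡ W * (B * a)
        e = solve-∀
      6q≤2^y : 6 * q ≤ 2 ^ y
      6q≤2^y = begin
        6 * q                              ≡⟨ cong (6 *_) q≡ ⟩
        6 * (W * (suc κ * (2 * m)))        ≡⟨ e W (suc κ) m ⟩
        12 * (W * suc κ) * m               ≤⟨ *-monoˡ-≤ m m-large ⟩
        m * m                              ≤⟨ *-mono-≤ (n≤2^n m) (n≤2^n m) ⟩
        2 ^ m * 2 ^ m                      ≡⟨ sym (^-distribˡ-+-* 2 m m) ⟩
        2 ^ (m + m)                        ≡⟨ cong (λ a → 2 ^ (m + a)) (sym (+-identityʳ m)) ⟩
        2 ^ y                              ∎
        where
        e : ∀ W K m → 6 * (W * (K * (2 * m))) ≡ 12 * (W * K) * m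
        e = solve-∀

-- Sample sizes range over all positive multiples of a constant, which leaves room for the divisor
-- `8 * e` that the colouring estimate imposes.
DegreeSample : ℕ → ℕ → Set
DegreeSample W B = ∃[ C ] (0 ℕ.< C ×
  (∀ {n} (G : Graph n) → 0 ℕ.< n → (∀ x → suc B * n ≤ W * deg G x) → ∀ q r → q ≡ C * r → 0 ℕ.< r →
   3 * ∑ᵛ {n} {q} (λ z → ∑ᶠ (λ i → # (W * deg (pullback G z) i <? B * q))) ≤ n ^ q))

degreeSample : ∀ W B .{{_ : NonZero W}} → DegreeSample W B
degreeSample W B = go (suc (Rate.κ B)) refl
  where
  go : ∀ K → K ≡ suc (Rate.κ B) → DegreeSample W B
  -- The constant comes from `m = 12 * (W * K) * r`, which is large enough for every positive `r`.
  go K K≡ = W * (K * (2 * (12 * (W * K)))) , 0<C , λ G 0<n dense q r q≡Cr 0<r →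
    Rate.few-low-degree B W G 0<n dense q (12 * (W * K) * r)
      (trans q≡Cr (trans (e₁ W K r) (cong (λ K′ → W * (K′ * (2 * (12 * (W * K) * r)))) K≡)))
      (subst (λ K′ → 12 * (W * K′) ≤ 12 * (W * K) * r) K≡ (m≤m*n (12 * (W * K)) r {{>-nonZero 0<r}}))
      (subst (0 ℕ.<_) (sym q≡Cr) (*-mono-< {0} {W * (K * (2 * (12 * (W * K))))} {0} 0<C 0<r))
    where
    0<WK : 0 ℕ.< W * K
    0<WK = *-mono-< {0} {W} {0} (>-nonZero⁻¹ W) (subst (0 ℕ.<_) (sym K≡) z<s)
    0<C : 0 ℕ.< W * (K * (2 * (12 * (W * K))))
    0<C = subst (0 ℕ.<_) (e₂ W K) (*-mono-< {0} {24} {0} z<s (*-mono-< {0} {W * K} {0} 0<WK 0<WK))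
      where
      e₂ : ∀ W K → 24 * (W * K * (W * K)) ≡ W * (K * (2 * (12 * (W * K))))
      e₂ = solve-∀
    e₁ : ∀ W K r → W * (K * (2 * (12 * (W * K)))) * r ≡ W * (K * (2 * (12 * (W * K) * r)))
    e₁ = solve-∀

-- Changing one entry of a sequence, and repeated entries

#-×-≤ : ∀ {P Q R : Set} (p : Dec P) (q : Dec Q) (r : Dec R) → (P → Q → R) → # p * # q ≤ # r
#-×-≤ (yes p) q r f = subst (_≤ # r) (sym (+-identityʳ (# q))) (#-mono q r (f p))
#-×-≤ (no _)  q r f = z≤n

∑-square : ∀ (xs : List X) (f : X → ℕ) → ∑ xs f * ∑ xs f ≡ ∑ xs (λ x → ∑ xs (λ y → f x * f y))
∑-square xs f = trans (sym (∑-*ʳ xs (∑ xs f) f)) (∑-cong xs (λ x → sym (∑-*ˡ xs (f x) f)))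

Edge-sym : ∀ (A : Graph n) {x y} → Edge A x y → Edge A y x
Edge-sym A {x} {y} e = trans (adj-sym A y x) e

Edge-irr : ∀ (A : Graph n) {x} → ¬ Edge A x x
Edge-irr A {x} e = contradiction (trans (sym e) (adj-irr A x)) λ ()

insertAt-other : ∀ {p} (z : Vec X p) {i j} a b → i ≢ j → lookup (insertAt z i a) j ≡ lookup (insertAt z i b) j
insertAt-other z {i} a b i≢j = subst (λ j → lookup (insertAt z i a) j ≡ lookup (insertAt z i b) j)
  (Fin.punchIn-punchOut i≢j)
  (trans (insertAt-punchIn z i a (punchOut i≢j)) (sym (insertAt-punchIn z i b (punchOut i≢j))))

∑ᶠ-≟ : ∀ (w : Fin n) → ∑ᶠ (λ u → # (u Fin.≟ w)) ≤ 1
∑ᶠ-≟ {suc n} w = ≤-trans (≤-reflexive (∑ᶠ-suc (λ u → # (u Fin.≟ w)))) (split w)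
  where
  split : ∀ w → # (Fin.zero Fin.≟ w) + ∑ᶠ {n} (λ u → # (Fin.suc u Fin.≟ w)) ≤ 1
  split Fin.zero    = ≤-reflexive (cong suc (trans (∑ᶠ-const n 0) (*-zeroʳ n)))
  split (Fin.suc w) = ≤-trans
    (∑-mono (allFin n) (λ u → #-mono (Fin.suc u Fin.≟ Fin.suc w) (u Fin.≟ w) Fin.suc-injective)) (∑ᶠ-≟ w)

repeats : ∀ {p} → Vec (Fin n) p → ℕ
repeats {p = zero}  z = 0
repeats {p = suc p} z = ∑ᶠ (λ i → ∑ᶠ (λ j → # (lookup z i Fin.≟ lookup z (punchIn i j))))

1≤repeats : ∀ {p} (z : Vec (Fin n) p) {i j} → i ≢ j → lookup z i ≡ lookup z j → 1 ≤ repeats z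
1≤repeats {p = suc p} z {i} {j} i≢j eq = begin
  1                                                              ≤⟨ 1≤# (lookup z i Fin.≟ lookup z (punchIn i j′)) (trans eq (cong (lookup z) (sym (Fin.punchIn-punchOut i≢j)))) ⟩
  # (lookup z i Fin.≟ lookup z (punchIn i j′))                   ≤⟨ ≤∑ᶠ (λ j → # (lookup z i Fin.≟ lookup z (punchIn i j))) j′ ⟩
  ∑ᶠ (λ j → # (lookup z i Fin.≟ lookup z (punchIn i j)))         ≤⟨ ≤∑ᶠ (λ i → ∑ᶠ (λ j → # (lookup z i Fin.≟ lookup z (punchIn i j)))) i ⟩
  repeats z                                                      ∎
  where
  open ≤-Reasoning
  j′ = punchOut i≢j

-- Two given distinct positions agree in at most one sequence out of `n`.
∑-repeats : ∀ {n} p → n * ∑ᵛ {n} {p} repeats ≤ p * p * n ^ p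
∑-repeats {n} zero    = ≤-reflexive (*-zeroʳ n)
∑-repeats {n} (suc p) = begin
  n * ∑ᵛ {n} {suc p} repeats
    ≡⟨ cong (n *_) (trans (∑-swap (vecs n (suc p)) (allFin (suc p)) _) (∑-cong (allFin (suc p)) (λ i → ∑-swap (vecs n (suc p)) (allFin p) _))) ⟩
  n * ∑ᶠ (λ i → ∑ᶠ (λ j → ∑ᵛ {n} {suc p} (λ z → # (lookup z i Fin.≟ lookup z (punchIn i j)))))
    ≤⟨ *-monoʳ-≤ n (∑ᶠ-bound (λ i → ∑ᶠ-bound (λ j → collide i j))) ⟩
  n * (suc p * (p * n ^ p))
    ≡⟨ e₁ n p (n ^ p) ⟩
  suc p * p * (n * n ^ p)
    ≤⟨ *-monoˡ-≤ (n ^ suc p) (*-monoʳ-≤ (suc p) (n≤1+n p)) ⟩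
  suc p * suc p * n ^ suc p ∎
  where
  open ≤-Reasoning
  e₁ : ∀ n p a → n * (suc p * (p * a)) ≡ suc p * p * (n * a)
  e₁ = solve-∀
  collide : ∀ i j → ∑ᵛ {n} {suc p} (λ z → # (lookup z i Fin.≟ lookup z (punchIn i j))) ≤ n ^ p
  collide i j = begin
    ∑ᵛ {n} {suc p} (λ z → # (lookup z i Fin.≟ lookup z (punchIn i j)))
      ≡⟨ ∑ᵛ-insertAt {n} {p} _ i ⟩
    ∑ᶠ (λ a → ∑ᵛ {n} {p} (λ z → # (lookup (insertAt z i a) i Fin.≟ lookup (insertAt z i a) (punchIn i j))))
      ≡⟨ ∑-cong (allFin n) (λ a → ∑-cong (vecs n p) (λ z → cong₂ (λ x y → # (x Fin.≟ y)) (insertAt-lookup z i a) (insertAt-punchIn z i a j))) ⟩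
    ∑ᶠ (λ a → ∑ᵛ {n} {p} (λ z → # (a Fin.≟ lookup z j)))
      ≡⟨ ∑-swap (allFin n) (vecs n p) _ ⟩
    ∑ᵛ {n} {p} (λ z → ∑ᶠ (λ a → # (a Fin.≟ lookup z j)))
      ≤⟨ ∑-mono (vecs n p) (λ z → ∑ᶠ-≟ (lookup z j)) ⟩
    ∑ᵛ {n} {p} (λ _ → 1)
      ≡⟨ trans (∑ᵛ-const {n} p 1) (*-identityʳ _) ⟩
    n ^ p ∎

collect : ∀ {P : X → Set} → Decidable P → List X → List (∃ P)
collect P? []       = []
collect P? (x ∷ xs) with P? x
... | yes p = (x , p) ∷ collect P? xs
... | no _  = collect P? xs

length-collect : ∀ {P : X → Set} (P? : Decidable P) xs → length (collect P? xs) ≡ ∑ xs (λ x → # (P? x))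
length-collect P? []       = refl
length-collect P? (x ∷ xs) with P? x
... | yes p = cong suc (length-collect P? xs)
... | no _  = length-collect P? xs

collect-All : ∀ {P : X → Set} (P? : Decidable P) {R : X → Set} {xs} → All R xs → All (R ∘ proj₁) (collect P? xs)
collect-All P? []                  = []
collect-All P? {xs = x ∷ xs} (r ∷ rs) with P? x
... | yes p = r ∷ collect-All P? rs
... | no _  = collect-All P? rs

collect-unique : ∀ {P : X → Set} (P? : Decidable P) {xs} → Unique xs →
                 AllPairs (λ y z → proj₁ y ≢ proj₁ z) (collect P? xs)
collect-unique P? []                  = []
collect-unique P? {x ∷ xs} (x∉ ∷ uxs) with P? x
... | yes p = collect-All P? x∉ ∷ collect-unique P? uxs
... | no _  = collect-unique P? uxs

-- From homomorphisms of a quotient to copies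

module Homs {v n} (H : Graph v) (G : Graph n) where

  isHom? : (g : Fin v → Fin n) → Dec (IsHom H G g)
  isHom? g = Fin.all? λ x → Fin.all? λ y → (adj H x y Bool.≟ true) →-dec (adj G (g x) (g y) Bool.≟ true)

  -- Up to scaling, the homomorphism density in `G` of the quotient of `H` by the fibres of `f`;
  -- positions outside the range of `f` are free.
  homs : ∀ {m} → (Fin v → Fin m) → ℕ
  homs {m} f = ∑ᵛ {n} {m} (λ z → # (isHom? (lookup z ∘ f)))

  homs-cong : ∀ {m} {f g : Fin v → Fin m} → (∀ x → f x ≡ g x) → homs f ≤ homs g
  homs-cong {m} {f} {g} f≗g = ∑-mono (vecs n m) λ z → #-mono (isHom? (lookup z ∘ f)) (isHom? (lookup z ∘ g))
    λ hom x y e → subst₂ (λ a b → Edge G (lookup z a) (lookup z b)) (f≗g x) (f≗g y) (hom x y e)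

  -- The old position of `x` remains for the vertices that share it, and becomes free if there are
  -- none.
  detach : ∀ {m} → (Fin v → Fin m) → Fin v → Fin v → Fin (suc m)
  detach f x w with w Fin.≟ x
  ... | yes _ = Fin.zero
  ... | no  _ = Fin.suc (f w)

  -- As `G` has no loops, a homomorphism through `f` keeps every neighbour of `x` off the position
  -- of `x`; so the images of the neighbours survive a change of that entry.
  detach-edge : ∀ {p} (f : Fin v → Fin (suc p)) x (z : Vec (Fin n) p) a b →
                IsHom H G (lookup (insertAt z (f x) a) ∘ f) →
                ∀ t → Edge H x t → Edge G a (lookup (insertAt z (f x) b) (f t))
  detach-edge f x z a b hom t e with f x Fin.≟ f t
  ... | yes fx≡ft = contradiction
    (subst (λ j → Edge G (lookup (insertAt z (f x) a) j) (lookup (insertAt z (f x) a) (f t))) fx≡ft (hom x t e))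
    (Edge-irr G)
  ... | no  fx≢ft = subst₂ (Edge G) (insertAt-lookup z (f x) a) (insertAt-other z a b fx≢ft) (hom x t e)

  -- Two homomorphisms that differ only in the entry at `f x` combine: `x` follows the first and all
  -- other vertices the second.
  detach-hom : ∀ {p} (f : Fin v → Fin (suc p)) x (z : Vec (Fin n) p) a b →
               IsHom H G (lookup (insertAt z (f x) a) ∘ f) → IsHom H G (lookup (insertAt z (f x) b) ∘ f) →
               IsHom H G (lookup (a ∷ insertAt z (f x) b) ∘ detach f x)
  detach-hom f x z a b homᵃ homᵇ s t e with s Fin.≟ x | t Fin.≟ x
  ... | yes refl | yes refl = contradiction e (Edge-irr H)
  ... | no _     | no _     = homᵇ s t e
  ... | yes refl | no _     = detach-edge f x z a b homᵃ t e
  ... | no _     | yes refl = Edge-sym G (detach-edge f x z a b homᵃ s (Edge-sym H e))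

  -- For each choice of the other entries, pairs of admissible entries at position `f x` yield
  -- homomorphisms through `detach f x`; by Cauchy-Schwarz the density is at worst squared.
  homs-detach : ∀ {m} (f : Fin v → Fin m) x → homs f * homs f * n ≤ n ^ m * homs (detach f x)
  homs-detach {zero}  f x = contradiction (f x) λ ()
  homs-detach {suc p} f x = begin
    homs f * homs f * n                                ≡⟨ cong (λ h → h * h * n) (trans (∑ᵛ-insertAt {n} {p} _ (f x)) (∑-swap (allFin n) (vecs n p) _)) ⟩
    ∑ᵛ {n} {p} B * ∑ᵛ {n} {p} B * n                    ≤⟨ *-monoˡ-≤ n (cauchy-schwarz (vecs n p) B) ⟩
    length (vecs n p) * ∑ᵛ {n} {p} (λ z → B z * B z) * n
                                                       ≡⟨ cong (λ l → l * ∑ᵛ {n} {p} (λ z → B z * B z) * n) (length-vecs n p) ⟩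
    n ^ p * ∑ᵛ {n} {p} (λ z → B z * B z) * n           ≡⟨ e₁ (n ^ p) _ n ⟩
    n ^ suc p * ∑ᵛ {n} {p} (λ z → B z * B z)           ≤⟨ *-monoʳ-≤ (n ^ suc p) squares ⟩
    n ^ suc p * homs (detach f x)                      ∎
    where
    open ≤-Reasoning
    e₁ : ∀ a b n → a * b * n ≡ n * a * b
    e₁ = solve-∀
    b? : ∀ a (z : Vec (Fin n) p) → Dec (IsHom H G (lookup (insertAt z (f x) a) ∘ f))
    b? a z = isHom? (lookup (insertAt z (f x) a) ∘ f)
    B : Vec (Fin n) p → ℕ
    B z = ∑ᶠ (λ a → # (b? a z))
    d? : ∀ a b (z : Vec (Fin n) p) → Dec (IsHom H G (lookup (a ∷ insertAt z (f x) b) ∘ detach f x))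
    d? a b z = isHom? (lookup (a ∷ insertAt z (f x) b) ∘ detach f x)
    squares : ∑ᵛ {n} {p} (λ z → B z * B z) ≤ homs (detach f x)
    squares = begin
      ∑ᵛ {n} {p} (λ z → B z * B z)
        ≡⟨ ∑-cong (vecs n p) (λ z → ∑-square (allFin n) (λ a → # (b? a z))) ⟩
      ∑ᵛ {n} {p} (λ z → ∑ᶠ (λ a → ∑ᶠ (λ b → # (b? a z) * # (b? b z))))
        ≤⟨ ∑-mono (vecs n p) (λ z → ∑-mono (allFin n) (λ a → ∑-mono (allFin n) (λ b →
             #-×-≤ (b? a z) (b? b z) (d? a b z) (detach-hom f x z a b)))) ⟩
      ∑ᵛ {n} {p} (λ z → ∑ᶠ (λ a → ∑ᶠ (λ b → # (d? a b z))))
        ≡⟨ ∑-swap (vecs n p) (allFin n) _ ⟩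
      ∑ᶠ (λ a → ∑ᵛ {n} {p} (λ z → ∑ᶠ (λ b → # (d? a b z))))
        ≡⟨ ∑-cong (allFin n) (λ a → trans (∑-swap (vecs n p) (allFin n) _)
             (sym (∑ᵛ-insertAt {n} {p} (λ z → # (isHom? (lookup (a ∷ z) ∘ detach f x))) (f x)))) ⟩
      ∑ᶠ (λ a → ∑ᵛ {n} {suc p} (λ z → # (isHom? (lookup (a ∷ z) ∘ detach f x))))
        ≡⟨ sym (∑ᵛ-suc {n} {suc p} _) ⟩
      homs (detach f x) ∎

  -- Vertices are detached from the last to the first and each detachment prepends a position.
  -- Hence, with `k` left to do, a vertex `w ≥ k` sits at position `w - k`, and in the end every
  -- vertex at its own index. Each round squares `A`.
  homs-detach-all : 0 ℕ.< n → ∀ q k i → k + i ≡ v → (f : Fin v → Fin (i + q)) →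
                    (∀ w → k ≤ toℕ w → toℕ (f w) + k ≡ toℕ w) →
                    ∀ A → n ^ (i + q) ≤ A * homs f → n ^ (v + q) ≤ A ^ (2 ^ k) * homs (_↑ˡ q)
  homs-detach-all 0<n q zero i refl f detached A bound = begin
    n ^ (v + q)              ≤⟨ bound ⟩
    A * homs f               ≤⟨ *-mono-≤ (≤-reflexive (sym (*-identityʳ A))) (homs-cong (λ w → Fin.toℕ-injective (trans (sym (+-identityʳ _)) (trans (detached w z≤n) (sym (Fin.toℕ-↑ˡ w q)))))) ⟩
    A ^ 1 * homs (_↑ˡ q)     ∎
    where open ≤-Reasoning
  homs-detach-all 0<n q (suc k) i eq f detached A bound =
    subst (λ a → n ^ (v + q) ≤ a * homs (_↑ˡ q)) A²^
      (homs-detach-all 0<n q k (suc i) (trans (+-suc k i) eq) (detach f x) detached′ (A * A) bound′)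
    where
    open ≤-Reasoning
    k<v : k ℕ.< v
    k<v = ≤-trans (m≤m+n (suc k) i) (≤-reflexive eq)
    x : Fin v
    x = Fin.fromℕ< k<v
    A²^ : (A * A) ^ (2 ^ k) ≡ A ^ (2 ^ suc k)
    A²^ = trans (cong (λ a → (A * a) ^ (2 ^ k)) (sym (*-identityʳ A))) (^-*-assoc A 2 (2 ^ k))
    detached′ : ∀ w → k ≤ toℕ w → toℕ (detach f x w) + k ≡ toℕ w
    detached′ w k≤w with w Fin.≟ x
    ... | yes refl = sym (Fin.toℕ-fromℕ< k<v)
    ... | no w≢x = trans (sym (+-suc (toℕ (f w)) k)) (detached w (≤∧≢⇒< k≤w λ k≡w →
                     w≢x (Fin.toℕ-injective (trans (sym k≡w) (sym (Fin.toℕ-fromℕ< k<v))))))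
    bound′ : n ^ (suc i + q) ≤ A * A * homs (detach f x)
    bound′ = *-cancelˡ-≤ (n ^ (i + q)) {{m^n≢0 n (i + q) {{>-nonZero 0<n}}}} (begin
      n ^ (i + q) * (n * n ^ (i + q))                ≡⟨ e₁ (n ^ (i + q)) n ⟩
      n ^ (i + q) * n ^ (i + q) * n                  ≤⟨ *-monoˡ-≤ n (*-mono-≤ bound bound) ⟩
      A * homs f * (A * homs f) * n                  ≡⟨ e₂ A (homs f) n ⟩
      A * A * (homs f * homs f * n)                  ≤⟨ *-monoʳ-≤ (A * A) (homs-detach f x) ⟩
      A * A * (n ^ (i + q) * homs (detach f x))      ≡⟨ e₃ (A * A) (n ^ (i + q)) _ ⟩
      n ^ (i + q) * (A * A * homs (detach f x))      ∎)
      where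
      e₁ : ∀ a n → a * (n * a) ≡ a * a * n
      e₁ = solve-∀
      e₂ : ∀ A h n → A * h * (A * h) * n ≡ A * A * (h * h * n)
      e₂ = solve-∀
      e₃ : ∀ a b c → a * (b * c) ≡ b * (a * c)
      e₃ = solve-∀

  homs-↑ˡ : ∀ q → homs (_↑ˡ q) ≡ n ^ q * homs id
  homs-↑ˡ q = begin
    homs (_↑ˡ q)
      ≡⟨ ∑ᵛ-++ v {q} _ ⟩
    ∑ᵛ {n} {v} (λ y → ∑ᵛ {n} {q} (λ z → # (isHom? (lookup (y Vec.++ z) ∘ (_↑ˡ q)))))
      ≡⟨ ∑-cong (vecs n v) (λ y → trans (∑-cong (vecs n q) (drop y)) (∑ᵛ-const {n} q _)) ⟩
    ∑ᵛ {n} {v} (λ y → n ^ q * # (isHom? (lookup y)))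
      ≡⟨ ∑-*ˡ (vecs n v) (n ^ q) _ ⟩
    n ^ q * homs id ∎
    where
    open ≡-Reasoning
    drop : ∀ y z → # (isHom? (lookup (y Vec.++ z) ∘ (_↑ˡ q))) ≡ # (isHom? (lookup y))
    drop y z = ≤-antisym
      (#-mono (isHom? _) (isHom? _) λ hom s t e → subst₂ (Edge G) (lookup-++ˡ y z s) (lookup-++ˡ y z t) (hom s t e))
      (#-mono (isHom? _) (isHom? _) λ hom s t e → subst₂ (Edge G) (sym (lookup-++ˡ y z s)) (sym (lookup-++ˡ y z t)) (hom s t e))

  homs-lower : 0 ℕ.< n → ∀ {q} (f : Fin v → Fin q) A → n ^ q ≤ A * homs f → n ^ v ≤ A ^ (2 ^ v) * homs id
  homs-lower 0<n {q} f A bound = *-cancelˡ-≤ (n ^ q) {{m^n≢0 n q {{>-nonZero 0<n}}}} (begin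
    n ^ q * n ^ v                        ≡⟨ trans (*-comm (n ^ q) _) (sym (^-distribˡ-+-* n v q)) ⟩
    n ^ (v + q)                          ≤⟨ homs-detach-all 0<n q v 0 (+-identityʳ v) f (λ w v≤w → contradiction (Fin.toℕ<n w) (≤⇒≯ v≤w)) A bound ⟩
    A ^ (2 ^ v) * homs (_↑ˡ q)           ≡⟨ cong (A ^ (2 ^ v) *_) (homs-↑ˡ q) ⟩
    A ^ (2 ^ v) * (n ^ q * homs id)      ≡⟨ e₁ (A ^ (2 ^ v)) (n ^ q) _ ⟩
    n ^ q * (A ^ (2 ^ v) * homs id)      ∎)
    where
    open ≤-Reasoning
    e₁ : ∀ a b c → a * (b * c) ≡ b * (a * c)
    e₁ = solve-∀

  isCopy? : ∀ g → Dec (IsCopy H G g)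
  isCopy? g = map′ (λ inj {x} {y} → inj x y) (λ inj x y → inj)
                   (Fin.all? λ x → Fin.all? λ y → (g x Fin.≟ g y) →-dec (x Fin.≟ y))
              ×-dec isHom? g

  copies : ℕ
  copies = ∑ᵛ {n} {v} (λ z → # (isCopy? (lookup z)))

  -- A homomorphism that is not a copy repeats a vertex, as does only a fraction `v * v / n` of all
  -- sequences.
  homs≤copies : n * homs id ≤ n * copies + v * v * n ^ v
  homs≤copies = begin
    n * homs id                                                 ≤⟨ *-monoʳ-≤ n (∑-mono (vecs n v) pointwise) ⟩
    n * ∑ᵛ {n} {v} (λ z → # (isCopy? (lookup z)) + repeats z)   ≡⟨ cong (n *_) (∑-+ (vecs n v) _ repeats) ⟩
    n * (copies + ∑ᵛ {n} {v} repeats)                           ≡⟨ *-distribˡ-+ n copies _ ⟩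
    n * copies + n * ∑ᵛ {n} {v} repeats                         ≤⟨ +-monoʳ-≤ (n * copies) (∑-repeats v) ⟩
    n * copies + v * v * n ^ v                                  ∎
    where
    open ≤-Reasoning
    pointwise : ∀ z → # (isHom? (lookup z)) ≤ # (isCopy? (lookup z)) + repeats z
    pointwise z = #≤ (isHom? (lookup z)) λ hom → split hom
      where
      split : IsHom H G (lookup z) → 1 ≤ # (isCopy? (lookup z)) + repeats z
      split hom with Fin.any? (λ x → Fin.any? (λ y → ¬? (x Fin.≟ y) ×-dec (lookup z x Fin.≟ lookup z y)))
      ... | yes (x , y , x≢y , eq) = ≤-trans (1≤repeats z x≢y eq) (m≤n+m _ _)
      ... | no none = ≤-trans (1≤# (isCopy? (lookup z)) (inj , hom)) (m≤m+n _ _)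
        where
        inj : Injective _≡_ _≡_ (lookup z)
        inj {x} {y} eq = decidable-stable (x Fin.≟ y) λ x≢y → none (x , y , x≢y , eq)

  copies⇒list : ∃[ cs ] (AllPairs (Distinct {H = H} {G = G}) cs × length cs ≡ copies)
  copies⇒list = map toCopy found
    , AllPairs.map⁺ (AllPairs.map (λ {y} {z} y≢z same → y≢z (lookup-injective (proj₁ y) (proj₁ z) same)) (collect-unique P? (vecs-unique n v)))
    , trans (length-map toCopy found) (length-collect P? (vecs n v))
    where
    P? : Decidable (λ z → IsCopy H G (lookup z))
    P? z = isCopy? (lookup z)
    found = collect P? (vecs n v)
    toCopy : ∃ (λ z → IsCopy H G (lookup z)) → Copy H G
    toCopy (z , copy) = lookup z , copy
    lookup-injective : ∀ (y z : Vec (Fin n) v) → (∀ i → lookup y i ≡ lookup z i) → y ≡ z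
    lookup-injective y z eq = trans (sym (tabulate∘lookup y)) (trans (tabulate-cong eq) (tabulate∘lookup z))

  -- Below the threshold 2Av² a single copy suffices; above it, non-injective
  -- homomorphisms are a minority.
  copies-lower : 0 ℕ.< n → Copy H G → ∀ A → n ^ v ≤ A * homs id → n ^ v ≤ (2 * A + (2 * A * (v * v)) ^ v) * copies
  copies-lower 0<n (c , c-inj , c-hom) A bound with n ≤? 2 * A * (v * v)
  ... | yes small = begin
    n ^ v                                          ≤⟨ ^-monoˡ-≤ v small ⟩
    (2 * A * (v * v)) ^ v                          ≡⟨ sym (*-identityʳ _) ⟩
    (2 * A * (v * v)) ^ v * 1                      ≤⟨ *-mono-≤ (m≤n+m _ (2 * A)) 1≤copies ⟩
    (2 * A + (2 * A * (v * v)) ^ v) * copies       ∎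
    where
    open ≤-Reasoning
    c′ = Vec.tabulate c
    l = lookup∘tabulate c
    1≤copies : 1 ≤ copies
    1≤copies = ≤-trans
      (1≤# (isCopy? (lookup c′))
        ( (λ {x} {y} eq → c-inj (trans (sym (l x)) (trans eq (l y))))
        , λ x y e → subst₂ (Edge G) (sym (l x)) (sym (l y)) (c-hom x y e)))
      (∈⇒≤∑ (λ z → # (isCopy? (lookup z))) (∈-vecs c′))
  ... | no large = *-cancelˡ-≤ n {{>-nonZero 0<n}} (+-cancelʳ-≤ (n * n ^ v) _ _ (begin
    n * n ^ v + n * n ^ v                                      ≡⟨ e₁ (n * n ^ v) ⟩
    2 * (n * n ^ v)                                            ≤⟨ *-monoʳ-≤ 2 (*-monoʳ-≤ n bound) ⟩
    2 * (n * (A * homs id))                                    ≡⟨ e₂ n A (homs id) ⟩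
    2 * A * (n * homs id)                                      ≤⟨ *-monoʳ-≤ (2 * A) homs≤copies ⟩
    2 * A * (n * copies + v * v * n ^ v)                       ≡⟨ e₃ (2 * A) n copies (v * v) (n ^ v) ⟩
    n * (2 * A * copies) + 2 * A * (v * v) * n ^ v             ≤⟨ +-mono-≤ (*-monoʳ-≤ n (*-monoˡ-≤ copies (m≤m+n (2 * A) _))) (*-monoˡ-≤ (n ^ v) (<⇒≤ (≰⇒> large))) ⟩
    n * ((2 * A + (2 * A * (v * v)) ^ v) * copies) + n * n ^ v ∎))
    where
    open ≤-Reasoning
    e₁ : ∀ a → a + a ≡ 2 * a
    e₁ = solve-∀
    e₂ : ∀ n A h → 2 * (n * (A * h)) ≡ 2 * A * (n * h)
    e₂ = solve-∀
    e₃ : ∀ a n c w p → a * (n * c + w * p) ≡ n * (a * c) + a * w * p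
    e₃ = solve-∀

-- Polynomial bounds and the sampling argument

PolyBounded : (ℕ → ℕ) → Set
PolyBounded f = ∃[ D ] ∃[ K ] (∀ e → 0 ℕ.< e → f e ≤ D * e ^ K)

poly-const : ∀ c → PolyBounded (λ _ → c)
poly-const c = c , 0 , λ e _ → ≤-reflexive (sym (*-identityʳ c))

poly-id : PolyBounded id
poly-id = 1 , 1 , λ e _ → ≤-reflexive (sym (trans (+-identityʳ _) (*-identityʳ e)))

poly-* : ∀ {f g} → PolyBounded f → PolyBounded g → PolyBounded (λ e → f e * g e)
poly-* {f} {g} (D , K , f≤) (D′ , K′ , g≤) = D * D′ , K + K′ , λ e 0<e → begin
  f e * g e                      ≤⟨ *-mono-≤ (f≤ e 0<e) (g≤ e 0<e) ⟩
  D * e ^ K * (D′ * e ^ K′)      ≡⟨ e₁ D (e ^ K) D′ (e ^ K′) ⟩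
  D * D′ * (e ^ K * e ^ K′)      ≡⟨ cong (D * D′ *_) (sym (^-distribˡ-+-* e K K′)) ⟩
  D * D′ * e ^ (K + K′)          ∎
  where
  open ≤-Reasoning
  e₁ : ∀ a b c d → a * b * (c * d) ≡ a * c * (b * d)
  e₁ = solve-∀

poly-+ : ∀ {f g} → PolyBounded f → PolyBounded g → PolyBounded (λ e → f e + g e)
poly-+ {f} {g} (D , K , f≤) (D′ , K′ , g≤) = D + D′ , K + K′ , λ e 0<e → begin
  f e + g e                                ≤⟨ +-mono-≤ (f≤ e 0<e) (g≤ e 0<e) ⟩
  D * e ^ K + D′ * e ^ K′                  ≤⟨ +-mono-≤ (*-monoʳ-≤ D (^-monoʳ-≤ e {{>-nonZero 0<e}} (m≤m+n K K′)))
                                                       (*-monoʳ-≤ D′ (^-monoʳ-≤ e {{>-nonZero 0<e}} (m≤n+m K′ K))) ⟩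
  D * e ^ (K + K′) + D′ * e ^ (K + K′)     ≡⟨ sym (*-distribʳ-+ _ D D′) ⟩
  (D + D′) * e ^ (K + K′)                  ∎
  where open ≤-Reasoning

poly-^ : ∀ {f} → PolyBounded f → ∀ k → PolyBounded (λ e → f e ^ k)
poly-^ p zero    = poly-const 1
poly-^ p (suc k) = poly-* p (poly-^ p k)

-- A uniformly random sequence of vertices inherits the minimum degree condition,
-- with a replaced by b, with probability at least 2/3.
DegreeInherited : ℚ → ℚ → Set
DegreeInherited a b = ∃[ C ] (0 ℕ.< C × (∀ {n} (G : Graph n) → 0 ℕ.< n → MinDeg≥ G a → ∀ q r → q ≡ C * r → 0 ℕ.< r →
  Σ (Vec (Fin n) q → ℕ) λ bad → (3 * ∑ᵛ {n} {q} bad ≤ n ^ q) × (∀ z → bad z ≡ 0 → MinDeg≥ (pullback G z) b)))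

-- Polynomial removal over ℕ: `e` plays the role of 1/ε and `D * e ^ K` that of the inverse density.
ManyCopies : ∀ {v} → Graph v → ℚ → Set
ManyCopies {v} H a = ∃[ D ] ∃[ K ] (∀ {e n} → 0 ℕ.< e → (G : Graph n) → 0 ℕ.< n → MinDeg≥ G a →
  {cs : List (Copy H G)} → AllPairs (EdgeDisjoint {H = H} {G = G}) cs → n * n ≤ e * length cs →
  n ^ v ≤ D * e ^ K * Homs.copies H G)

-- Nothing can be sampled from an empty vertex set, so this case is separate; for `v = 0` the demand
-- is `0 ^ 0 = 1` copy, met by the empty map.
manyCopies₀ : ∀ {v} (H : Graph v) (G : Graph 0) →
              ∃[ cs ] (AllPairs (Distinct {H = H} {G = G}) cs × 0 ^ v ≤ length cs)
manyCopies₀ {zero}  H G = ((λ ()) , (λ { {()} }) , λ ()) ∷ [] , [] ∷ [] , ≤-refl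
manyCopies₀ {suc _} H G = [] , [] , z≤n

module _ {v} (H : Graph v) where

  someCopy : ∀ {n e} {G : Graph n} → 0 ℕ.< n → (cs : List (Copy H G)) → n * n ≤ e * length cs → Copy H G
  someCopy {n} {e} 0<n []      h = contradiction (≤-trans h (≤-reflexive (*-zeroʳ e))) (<⇒≱ (*-mono-< {0} {n} {0} 0<n 0<n))
  someCopy         _   (c ∷ _) _ = c

  module _ {a b} (homAt : HomAt H b) (inherited : DegreeInherited a b) where
    private
      N = proj₁ homAt
      F = proj₁ (proj₂ homAt)
      F-free = proj₁ (proj₂ (proj₂ homAt))
      toF = proj₂ (proj₂ (proj₂ homAt))
      C = proj₁ inherited

    module _ {e n} (0<e : 0 ℕ.< e) (G : Graph n) (0<n : 0 ℕ.< n) (minDeg : MinDeg≥ G a)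
             {cs : List (Copy H G)} (disjoint : AllPairs (EdgeDisjoint {H = H} {G = G}) cs)
             (many : n * n ≤ e * length cs) where
      open ≤-Reasoning
      open Homs H G
      open ListColoring G F

      -- The two factorizations of `q` are the demands of the degree and the colouring estimates,
      -- each of which sets aside at most a third of the samples.
      manyHoms : ∀ q r ℓ → q ≡ C * r → 0 ℕ.< r → q ≡ 8 * e * ℓ → 2 + 2 * suc N * (4 * e * N) ≤ ℓ →
                 n ^ v ≤ (q ^ v * 3) ^ (2 ^ v) * homs id
      manyHoms q r ℓ q≡Cr 0<r q≡8eℓ ℓ-large = homs-lower 0<n (lookup f) (q ^ v * 3) f-many
        where
        far : ∀ φ → n * n ≤ e * ∑ᶠ (λ x → ∑ᶠ (λ y → ind (violated G F φ x y)))
        far φ = ≤-trans many (*-monoʳ-≤ e (edgeDisjoint⇒violated {H = H} {G} {F} (IFree⇒¬⟶ {H = H} {F} F-free) disjoint φ))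

        sampled = proj₂ (proj₂ inherited) G 0<n minDeg q r q≡Cr 0<r
        bad = proj₁ sampled

        col : Vec (Fin n) q → ℕ
        col z = # (colorable? (λ _ _ → true) z)

        3col≤ : 3 * ∑ᵛ {n} {q} col ≤ n ^ q
        3col≤ = subst (λ q → 3 * ∑ᵛ {n} {q} (λ z → # (colorable? (λ _ _ → true) z)) ≤ n ^ q) (sym q≡8eℓ)
          (few-colorable G F 0<e 0<n far ℓ ℓ-large)

        hits : Vec (Fin n) q → ℕ
        hits z = ∑ (vecs q v) (λ f → # (isHom? (lookup z ∘ lookup f)))

        -- A sample of sufficient degree that does not receive `H` is mapped to `F` by the
        -- assumption on `F`, hence colourable.
        cover : ∀ z → 1 ≤ col z + bad z + hits z
        cover z with 1 ≤? hits z | bad z ≟ 0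
        ... | yes hit | _      = ≤-trans hit (m≤n+m _ _)
        ... | no _    | no bz  = ≤-trans (n≢0⇒n>0 bz) (≤-trans (m≤n+m _ (col z)) (m≤m+n _ _))
        ... | no ¬hit | yes bz = ≤-trans (1≤# (colorable? (λ _ _ → true) z) colored) (≤-trans (m≤m+n _ _) (m≤m+n _ _))
          where
          ¬hom : ¬ (H ⟶ pullback G z)
          ¬hom (ψ , ψ-hom) = ¬hit (≤-trans
            (1≤# (isHom? (lookup z ∘ lookup (tabulate ψ)))
              (λ x y e → subst₂ (λ i j → Edge G (lookup z i) (lookup z j)) (sym (lookup∘tabulate ψ x)) (sym (lookup∘tabulate ψ y)) (ψ-hom x y e)))
            (∈⇒≤∑ (λ f → # (isHom? (lookup z ∘ lookup f))) (∈-vecs (tabulate ψ))))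
          G[z]⟶F : pullback G z ⟶ F
          G[z]⟶F = toF q (pullback G z) (¬⟶⇒IFree {H = H} {pullback G z} ¬hom) (proj₂ (proj₂ sampled) z bz)
          colored : Colorable (λ _ _ → true) z
          colored = hom⇒Colorable z (proj₁ G[z]⟶F) (proj₂ G[z]⟶F) (λ _ → refl)

        total : n ^ q ≤ ∑ (vecs q v) (λ f → 3 * homs (lookup f))
        total = +-cancelˡ-≤ (n ^ q + n ^ q) _ _ (begin
          n ^ q + n ^ q + n ^ q
            ≡⟨ e₁ (n ^ q) ⟩
          3 * (n ^ q * 1)
            ≡⟨ cong (3 *_) (sym (∑ᵛ-const {n} q 1)) ⟩
          3 * ∑ᵛ {n} {q} (λ _ → 1)
            ≤⟨ *-monoʳ-≤ 3 (∑-mono (vecs n q) cover) ⟩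
          3 * ∑ᵛ {n} {q} (λ z → col z + bad z + hits z)
            ≡⟨ cong (3 *_) (trans (∑-+ (vecs n q) _ hits) (cong₂ _+_ (∑-+ (vecs n q) col bad) (∑-swap (vecs n q) (vecs q v) _))) ⟩
          3 * (∑ᵛ {n} {q} col + ∑ᵛ {n} {q} bad + ∑ (vecs q v) (λ f → homs (lookup f)))
            ≡⟨ e₂ (∑ᵛ {n} {q} col) (∑ᵛ {n} {q} bad) _ ⟩
          3 * ∑ᵛ {n} {q} col + 3 * ∑ᵛ {n} {q} bad + 3 * ∑ (vecs q v) (λ f → homs (lookup f))
            ≤⟨ +-mono-≤ (+-mono-≤ 3col≤ (proj₁ (proj₂ sampled))) (≤-reflexive (sym (∑-*ˡ (vecs q v) 3 _))) ⟩
          n ^ q + n ^ q + ∑ (vecs q v) (λ f → 3 * homs (lookup f)) ∎)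
          where
          e₁ : ∀ a → a + a + a ≡ 3 * (a * 1)
          e₁ = solve-∀
          e₂ : ∀ a b c → 3 * (a + b + c) ≡ 3 * a + 3 * b + 3 * c
          e₂ = solve-∀

        -- A single one of the `q ^ v` maps from `V(H)` to positions serves an average share of the
        -- samples.
        likely = pigeonhole (vecs q v) (λ f → 3 * homs (lookup f)) (m^n>0 n {{>-nonZero 0<n}} q) total
        f = proj₁ likely
        f-many : n ^ q ≤ q ^ v * 3 * homs (lookup f)
        f-many = ≤-trans (proj₂ likely) (≤-reflexive (trans (cong (_* (3 * homs (lookup f))) (length-vecs q v)) (sym (*-assoc (q ^ v) 3 _))))

    manyCopies : ManyCopies H a
    -- `ℓ₀` is the bound required of `ℓ` at `e = 1`; as that bound is affine in `e`, any
    -- `ℓ ≥ e * ℓ₀` suffices.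
    manyCopies = go (2 + 2 * suc N * (4 * N)) refl
      where
      go : ∀ ℓ₀ → ℓ₀ ≡ 2 + 2 * suc N * (4 * N) → ManyCopies H a
      go ℓ₀ ℓ₀≡ = proj₁ factor-poly , proj₁ (proj₂ factor-poly) , bound
        where
        open ≤-Reasoning
        size′ A factor : ℕ → ℕ
        size′ e  = 8 * e * (e * (C * ℓ₀))
        A e      = (size′ e ^ v * 3) ^ (2 ^ v)
        factor e = 2 * A e + (2 * A e * (v * v)) ^ v
        factor-poly : PolyBounded factor
        factor-poly = poly-+ (poly-* (poly-const 2) A-poly) (poly-^ (poly-* (poly-* (poly-const 2) A-poly) (poly-const (v * v))) v)
          where
          size-poly = poly-* (poly-* (poly-const 8) poly-id) (poly-* poly-id (poly-const (C * ℓ₀)))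
          A-poly = poly-^ (poly-* (poly-^ size-poly v) (poly-const 3)) (2 ^ v)
        e₁ : ∀ e C l → 8 * e * (e * (C * l)) ≡ C * (8 * e * (e * l))
        e₁ = solve-∀
        0<r : ∀ e → 0 ℕ.< e → 0 ℕ.< 8 * e * (e * ℓ₀)
        0<r e 0<e = *-mono-< {0} {8 * e} {0} (*-mono-< {0} {8} {0} z<s 0<e)
          (*-mono-< {0} {e} {0} 0<e (subst (0 ℕ.<_) (sym ℓ₀≡) z<s))
        ℓ-large : ∀ e → 0 ℕ.< e → 2 + 2 * suc N * (4 * e * N) ≤ e * (C * ℓ₀)
        ℓ-large e 0<e = begin
          2 + 2 * suc N * (4 * e * N)            ≤⟨ +-monoˡ-≤ _ (*-monoʳ-≤ 2 0<e) ⟩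
          2 * e + 2 * suc N * (4 * e * N)        ≡⟨ e₂ e (2 * suc N) N ⟩
          e * (2 + 2 * suc N * (4 * N))          ≡⟨ cong (e *_) (sym ℓ₀≡) ⟩
          e * ℓ₀                                 ≤⟨ *-monoʳ-≤ e (m≤n*m ℓ₀ C {{>-nonZero (proj₁ (proj₂ inherited))}}) ⟩
          e * (C * ℓ₀)                           ∎
          where
          e₂ : ∀ e b N → 2 * e + b * (4 * e * N) ≡ e * (2 + b * (4 * N))
          e₂ = solve-∀
        bound : ∀ {e n} → 0 ℕ.< e → (G : Graph n) → 0 ℕ.< n → MinDeg≥ G a →
                {cs : List (Copy H G)} → AllPairs (EdgeDisjoint {H = H} {G = G}) cs → n * n ≤ e * length cs →
                n ^ v ≤ proj₁ factor-poly * e ^ proj₁ (proj₂ factor-poly) * Homs.copies H G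
        bound {e} {n} 0<e G 0<n minDeg {cs} disjoint many = begin
          n ^ v                              ≤⟨ Homs.copies-lower H G 0<n (someCopy {e = e} {G = G} 0<n cs many) (A e) homs≥ ⟩
          factor e * Homs.copies H G         ≤⟨ *-monoˡ-≤ (Homs.copies H G) (proj₂ (proj₂ factor-poly) e 0<e) ⟩
          proj₁ factor-poly * e ^ proj₁ (proj₂ factor-poly) * Homs.copies H G ∎
          where
          homs≥ : n ^ v ≤ A e * Homs.homs H G id
          homs≥ = manyHoms 0<e G 0<n minDeg disjoint many (size′ e) (8 * e * (e * ℓ₀)) (e * (C * ℓ₀))
                    (e₁ e C ℓ₀) (0<r e 0<e) refl (ℓ-large e 0<e)

-- Translation between rational and integral inequalities

toℚᵘ-ℕ→ℚ : ∀ n → toℚᵘ (ℕ→ℚ n) ℚᵘ.≃ mkℚᵘ (ℤ.+ n) 0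
toℚᵘ-ℕ→ℚ n = ℚ.toℚᵘ-fromℚᵘ (mkℚᵘ (ℤ.+ n) 0)

ℕ→ℚ-mono-≤ : ∀ m n → m ≤ n → ℕ→ℚ m ℚ.≤ ℕ→ℚ n
ℕ→ℚ-mono-≤ m n m≤n = ℚ.toℚᵘ-cancel-≤
  (ℚᵘ.≤-respˡ-≃ (ℚᵘ.≃-sym (toℚᵘ-ℕ→ℚ m)) (ℚᵘ.≤-respʳ-≃ (ℚᵘ.≃-sym (toℚᵘ-ℕ→ℚ n))
    (ℚᵘ.*≤* (ℤ.*-monoʳ-≤-nonNeg (ℤ.+ 1) (ℤ.+≤+ m≤n)))))

ℕ→ℚ-cancel-≤ : ∀ m n → ℕ→ℚ m ℚ.≤ ℕ→ℚ n → m ≤ n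
ℕ→ℚ-cancel-≤ m n m≤n = ℤ.drop‿+≤+ (ℤ.*-cancelʳ-≤-pos (ℤ.+ m) (ℤ.+ n) (ℤ.+ 1) (ℚᵘ.drop-*≤*
  (ℚᵘ.≤-respˡ-≃ (toℚᵘ-ℕ→ℚ m) (ℚᵘ.≤-respʳ-≃ (toℚᵘ-ℕ→ℚ n) (ℚ.toℚᵘ-mono-≤ m≤n)))))

ℕ→ℚ-* : ∀ m n → ℕ→ℚ (m * n) ≡ ℕ→ℚ m ℚ.* ℕ→ℚ n
ℕ→ℚ-* m n = ℚ.toℚᵘ-injective (begin
  toℚᵘ (ℕ→ℚ (m * n))                 ≈⟨ toℚᵘ-ℕ→ℚ (m * n) ⟩
  mkℚᵘ (ℤ.+ (m * n)) 0                 ≡⟨ cong (λ a → mkℚᵘ a 0) (ℤ.pos-* m n) ⟩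
  mkℚᵘ (ℤ.+ m) 0 ℚᵘ.* mkℚᵘ (ℤ.+ n) 0       ≈⟨ ℚᵘ.*-cong (toℚᵘ-ℕ→ℚ m) (toℚᵘ-ℕ→ℚ n) ⟨
  toℚᵘ (ℕ→ℚ m) ℚᵘ.* toℚᵘ (ℕ→ℚ n)       ≈⟨ ℚ.toℚᵘ-homo-* (ℕ→ℚ m) (ℕ→ℚ n) ⟨
  toℚᵘ (ℕ→ℚ m ℚ.* ℕ→ℚ n)               ∎)
  where open ℚᵘ.≃-Reasoning

ℕ→ℚ-nonNeg : ∀ n → ℚ.NonNegative (ℕ→ℚ n)
ℕ→ℚ-nonNeg n = ℚ.nonNegative (ℕ→ℚ-mono-≤ 0 n z≤n)

ℕ→ℚ-pos : ∀ n → ℚ.Positive (ℕ→ℚ (suc n))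
ℕ→ℚ-pos n = ℚ.normalize-pos (suc n) 1

infix 4 _≐_/_
-- Fractions need not be reduced, so products and powers are formed on numerators and denominators
-- separately.
record _≐_/_ (p : ℚ) (s t : ℕ) : Set where
  constructor by
  field scaled : p ℚ.* ℕ→ℚ t ≡ ℕ→ℚ s
open _≐_/_

fraction : ∀ s t → ((ℤ.+ s) ℚ./ suc t) ≐ s / suc t
fraction s t = by (ℚ.toℚᵘ-injective (begin
  toℚᵘ (((ℤ.+ s) ℚ./ suc t) ℚ.* ℕ→ℚ (suc t))         ≈⟨ ℚ.toℚᵘ-homo-* ((ℤ.+ s) ℚ./ suc t) (ℕ→ℚ (suc t)) ⟩
  toℚᵘ ((ℤ.+ s) ℚ./ suc t) ℚᵘ.* toℚᵘ (ℕ→ℚ (suc t))   ≈⟨ ℚᵘ.*-cong (ℚ.toℚᵘ-fromℚᵘ (mkℚᵘ (ℤ.+ s) t)) (toℚᵘ-ℕ→ℚ (suc t)) ⟩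
  mkℚᵘ (ℤ.+ s) t ℚᵘ.* mkℚᵘ (ℤ.+ suc t) 0               ≈⟨ ℚᵘ.*≡* (trans (ℤ.*-identityʳ (ℤ.+ s ℤ.* ℤ.+ suc t)) (cong (λ a → ℤ.+ s ℤ.* ℤ.+ suc a) (sym (*-identityʳ t)))) ⟩
  mkℚᵘ (ℤ.+ s) 0                                     ≈⟨ toℚᵘ-ℕ→ℚ s ⟨
  toℚᵘ (ℕ→ℚ s)                                     ∎))
  where open ℚᵘ.≃-Reasoning

≐-canonical : ∀ p {s} → ℚ.numerator p ≡ ℤ.+ s → p ≐ s / ℚ.↧ₙ p
≐-canonical p {s} num≡ = subst (_≐ s / ℚ.↧ₙ p)
  (trans (cong (λ a → a ℚ./ ℚ.↧ₙ p) (sym num≡)) (ℚ.↥p/↧p≡p p)) (fraction s (ℚ.denominator-1 p))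

≐-* : ∀ {p p′ s s′ t t′} → p ≐ s / t → p′ ≐ s′ / t′ → p ℚ.* p′ ≐ s * s′ / t * t′
≐-* {p} {p′} {s} {s′} {t} {t′} (by p≐) (by p′≐) = by (begin
  p ℚ.* p′ ℚ.* ℕ→ℚ (t * t′)              ≡⟨ cong (p ℚ.* p′ ℚ.*_) (ℕ→ℚ-* t t′) ⟩
  p ℚ.* p′ ℚ.* (ℕ→ℚ t ℚ.* ℕ→ℚ t′)          ≡⟨ interchange p p′ (ℕ→ℚ t) (ℕ→ℚ t′) ⟩
  p ℚ.* ℕ→ℚ t ℚ.* (p′ ℚ.* ℕ→ℚ t′)          ≡⟨ cong₂ ℚ._*_ p≐ p′≐ ⟩
  ℕ→ℚ s ℚ.* ℕ→ℚ s′                         ≡⟨ sym (ℕ→ℚ-* s s′) ⟩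
  ℕ→ℚ (s * s′)                           ∎)
  where
  open ≡-Reasoning
  interchange : ∀ a b c d → a ℚ.* b ℚ.* (c ℚ.* d) ≡ a ℚ.* c ℚ.* (b ℚ.* d)
  interchange a b c d = trans (ℚ.*-assoc a b (c ℚ.* d)) (trans (cong (a ℚ.*_) (trans (sym (ℚ.*-assoc b c d))
    (trans (cong (ℚ._* d) (ℚ.*-comm b c)) (ℚ.*-assoc c b d)))) (sym (ℚ.*-assoc a c (b ℚ.* d))))

≐-^ : ∀ {p s t} → p ≐ s / t → ∀ k → p ^ℚ k ≐ s ^ k / t ^ k
≐-^ p≐ zero    = by (ℚ.*-identityˡ _)
≐-^ p≐ (suc k) = ≐-* p≐ (≐-^ p≐ k)

scaled-numerator : ∀ {p s t} → p ≐ s / t → ∀ n → p ℚ.* ℕ→ℚ n ℚ.* ℕ→ℚ t ≡ ℕ→ℚ (s * n)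
scaled-numerator {p} {s} {t} p≐ n = begin
  p ℚ.* ℕ→ℚ n ℚ.* ℕ→ℚ t        ≡⟨ ℚ.*-assoc p _ _ ⟩
  p ℚ.* (ℕ→ℚ n ℚ.* ℕ→ℚ t)      ≡⟨ cong (p ℚ.*_) (ℚ.*-comm (ℕ→ℚ n) (ℕ→ℚ t)) ⟩
  p ℚ.* (ℕ→ℚ t ℚ.* ℕ→ℚ n)      ≡⟨ sym (ℚ.*-assoc p _ _) ⟩
  p ℚ.* ℕ→ℚ t ℚ.* ℕ→ℚ n        ≡⟨ cong (ℚ._* ℕ→ℚ n) (scaled p≐) ⟩
  ℕ→ℚ s ℚ.* ℕ→ℚ n              ≡⟨ sym (ℕ→ℚ-* s n) ⟩
  ℕ→ℚ (s * n)                ∎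
  where open ≡-Reasoning

scaled-≤⁻ : ∀ {p s t} → p ≐ s / t → ∀ n m → p ℚ.* ℕ→ℚ n ℚ.≤ ℕ→ℚ m → s * n ≤ m * t
scaled-≤⁻ {p} {s} {t} p≐ n m h = ℕ→ℚ-cancel-≤ (s * n) (m * t) (subst₂ ℚ._≤_ (scaled-numerator p≐ n) (sym (ℕ→ℚ-* m t))
  (ℚ.*-monoʳ-≤-nonNeg (ℕ→ℚ t) {{ℕ→ℚ-nonNeg t}} h))

scaled-≤⁺ : ∀ {p s t} .{{_ : NonZero t}} → p ≐ s / t → ∀ n m → s * n ≤ m * t → p ℚ.* ℕ→ℚ n ℚ.≤ ℕ→ℚ m
scaled-≤⁺ {p} {s} {t@(suc t′)} p≐ n m h = ℚ.*-cancelʳ-≤-pos (ℕ→ℚ t) {{ℕ→ℚ-pos t′}}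
  (subst₂ ℚ._≤_ (sym (scaled-numerator p≐ n)) (ℕ→ℚ-* m t) (ℕ→ℚ-mono-≤ (s * n) (m * t) h))

-- Inheritance of rational degree thresholds

degreeInherited-neg : ∀ a b .{{_ : ℚ.Negative b}} → DegreeInherited a b
degreeInherited-neg a b = 1 , z<s , λ {n} G _ _ q r _ _ →
  (λ _ → 0) , subst (_≤ n ^ q) (sym (cong (3 *_) (trans (∑ᵛ-const {n} q 0) (*-zeroʳ (n ^ q))))) z≤n ,
  λ z _ x → ℚ.≤-trans
    (subst (b ℚ.* ℕ→ℚ q ℚ.≤_) (ℚ.*-zeroˡ (ℕ→ℚ q)) (ℚ.*-monoʳ-≤-nonNeg (ℕ→ℚ q) {{ℕ→ℚ-nonNeg q}} (ℚ.<⇒≤ (ℚ.negative⁻¹ b))))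
    (ℕ→ℚ-mono-≤ 0 (deg (pullback G z) x) z≤n)

-- Over the common denominator `W = b₂ * a₂`, `b` is `B / W` and, numerators being integers, `a` is
-- at least `(B + 1) / W`.
degreeInherited-≐ : ∀ {a b a₁ a₂ b₁ b₂} .{{_ : NonZero a₂}} .{{_ : NonZero b₂}} →
                    a ≐ a₁ / a₂ → b ≐ b₁ / b₂ → b₁ * a₂ ℕ.< a₁ * b₂ →
                    DegreeSample (b₂ * a₂) (b₁ * a₂) → DegreeInherited a b
degreeInherited-≐ {a} {b} {a₁} {a₂} {b₁} {b₂} a≐ b≐ b<a (C , 0<C , few) = C , 0<C , sample
  where
  open ≤-Reasoning
  B = b₁ * a₂
  W = b₂ * a₂
  sample : ∀ {n} (G : Graph n) → 0 ℕ.< n → MinDeg≥ G a → ∀ q r → q ≡ C * r → 0 ℕ.< r →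
           Σ (Vec (Fin n) q → ℕ) λ bad → (3 * ∑ᵛ {n} {q} bad ≤ n ^ q) × (∀ z → bad z ≡ 0 → MinDeg≥ (pullback G z) b)
  sample {n} G 0<n minDeg q r q≡Cr 0<r = bad , few G 0<n dense q r q≡Cr 0<r , inherit
    where
    bad : Vec (Fin n) q → ℕ
    bad z = ∑ᶠ (λ i → # (W * deg (pullback G z) i <? B * q))
    dense : ∀ x → suc B * n ≤ W * deg G x
    dense x = begin
      suc B * n              ≤⟨ *-monoˡ-≤ n b<a ⟩
      a₁ * b₂ * n            ≡⟨ e₂ a₁ b₂ n ⟩
      b₂ * (a₁ * n)          ≤⟨ *-monoʳ-≤ b₂ (scaled-≤⁻ a≐ n (deg G x) (minDeg x)) ⟩
      b₂ * (deg G x * a₂)    ≡⟨ e₃ b₂ (deg G x) a₂ ⟩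
      W * deg G x            ∎
      where
      e₂ : ∀ a b n → a * b * n ≡ b * (a * n)
      e₂ = solve-∀
      e₃ : ∀ b d a → b * (d * a) ≡ b * a * d
      e₃ = solve-∀
    inherit : ∀ z → bad z ≡ 0 → MinDeg≥ (pullback G z) b
    inherit z none i = scaled-≤⁺ b≐ q (deg (pullback G z) i) (*-cancelʳ-≤ (b₁ * q) (deg (pullback G z) i * b₂) a₂ (begin
      b₁ * q * a₂                          ≡⟨ e₂ b₁ q a₂ ⟩
      B * q                                ≤⟨ ≮⇒≥ ¬low ⟩
      W * deg (pullback G z) i             ≡⟨ e₃ b₂ a₂ _ ⟩
      deg (pullback G z) i * b₂ * a₂       ∎))
      where
      ¬low : ¬ (W * deg (pullback G z) i ℕ.< B * q)
      ¬low low = contradiction (subst (1 ≤_) none (≤-trans (1≤# (W * deg (pullback G z) i <? B * q) low) (≤∑ᶠ (λ i → # (W * deg (pullback G z) i <? B * q)) i))) λ ()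
      e₂ : ∀ b q a → b * q * a ≡ b * a * q
      e₂ = solve-∀
      e₃ : ∀ b a d → b * a * d ≡ d * b * a
      e₃ = solve-∀

degreeInherited : ∀ {a b} → b < a → DegreeInherited a b
degreeInherited {a} {b@(mkℚ -[1+ _ ] _ _)} _ = degreeInherited-neg a b
-- Here `a` is negative and `b` is not, against `b < a`.
degreeInherited {mkℚ -[1+ _ ] _ _} {mkℚ (ℤ.+ b₁) _ _} (ℚ.*<* b<a) =
  contradiction (ℤ.<-trans (ℤ.≤-<-trans (subst (ℤ.0ℤ ℤ.≤_) (ℤ.pos-* b₁ _) (ℤ.+≤+ z≤n)) b<a) ℤ.-<+) (ℤ.<-irrefl {ℤ.0ℤ} refl)
degreeInherited {a@(mkℚ (ℤ.+ a₁) a₂ _)} {b@(mkℚ (ℤ.+ b₁) b₂ _)} (ℚ.*<* b<a) =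
  degreeInherited-≐ (≐-canonical a refl) (≐-canonical b refl)
    (ℤ.drop‿+<+ (subst₂ ℤ._<_ (sym (ℤ.pos-* b₁ (suc a₂))) (sym (ℤ.pos-* a₁ (suc b₂))) b<a))
    (degreeSample (suc b₂ * suc a₂) (b₁ * suc a₂))

-- Replacing ε by an integer and choosing μ

positive-≐ : ∀ ε → 0ℚ < ε → ∃[ s ] ∃[ t ] (NonZero s × NonZero t × ε ≐ s / t)
positive-≐ (mkℚ -[1+ _ ] _ _)      0<ε = contradiction 0<ε (ℚ.<-asym (ℚ.negative⁻¹ _))
positive-≐ (mkℚ (ℤ.+ 0) _ _)       0<ε = contradiction (ℚ.positive 0<ε) λ ()
positive-≐ ε@(mkℚ (ℤ.+ suc _) _ _) 0<ε = _ , _ , _ , _ , ≐-canonical ε refl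

-- `e` is one more than the integer part of 1/ε, where ε = s/t; as ε ≤ 1, the rounding loses at most
-- a factor 2.
ceiling : ∀ s t .{{_ : NonZero s}} → s ≤ t → ∃[ e ] (0 ℕ.< e × t ≤ e * s × e * s ≤ 2 * t)
ceiling s t s≤t = suc (t / s) , z<s , (begin
    t                      ≡⟨ m≡m%n+[m/n]*n t s ⟩
    t % s + t / s * s      ≤⟨ +-monoˡ-≤ _ (<⇒≤ (m%n<n t s)) ⟩
    s + t / s * s          ∎) , (begin
    s + t / s * s          ≤⟨ +-mono-≤ s≤t (m/n*n≤m t s) ⟩
    t + t                  ≡⟨ cong (t +_) (sym (+-identityʳ t)) ⟩
    2 * t                  ∎)
  where open ≤-Reasoning

-- From `e ≤ 2t/s`, `D * e ^ K` is at most `D * 2 ^ K` times `(t/s) ^ K`, and `t/s ≥ 1` lets the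
-- exponent grow to `J`. One number thus serves as coefficient and exponent, as the form μ ε^(1/μ)
-- requires.
absorb-constants : ∀ {s t e D K J m ℓ} → s ≤ t → e * s ≤ 2 * t → D * 2 ^ K ≤ J → K ≤ J →
                   m ≤ D * e ^ K * ℓ → s ^ J * m ≤ ℓ * (J * t ^ J)
absorb-constants {s} {t} {e} {D} {K} {J} {m} {ℓ} s≤t es≤2t D≤J K≤J enough = begin
  s ^ J * m                                  ≡⟨ cong (_* m) (split s) ⟩
  s ^ i * s ^ K * m                          ≤⟨ *-mono-≤ (*-monoˡ-≤ (s ^ K) (^-monoˡ-≤ i s≤t)) enough ⟩
  t ^ i * s ^ K * (D * e ^ K * ℓ)            ≡⟨ e₁ (t ^ i) (s ^ K) D (e ^ K) ℓ ⟩
  ℓ * (D * (t ^ i * (e ^ K * s ^ K)))        ≡⟨ cong (λ a → ℓ * (D * (t ^ i * a))) (sym (^-distribʳ-* e s K)) ⟩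
  ℓ * (D * (t ^ i * (e * s) ^ K))            ≤⟨ *-monoʳ-≤ ℓ (*-monoʳ-≤ D (*-monoʳ-≤ (t ^ i) (^-monoˡ-≤ K es≤2t))) ⟩
  ℓ * (D * (t ^ i * (2 * t) ^ K))            ≡⟨ cong (λ a → ℓ * (D * (t ^ i * a))) (^-distribʳ-* 2 t K) ⟩
  ℓ * (D * (t ^ i * (2 ^ K * t ^ K)))        ≡⟨ e₂ ℓ D (t ^ i) (2 ^ K) (t ^ K) ⟩
  ℓ * (D * 2 ^ K * (t ^ i * t ^ K))          ≤⟨ *-monoʳ-≤ ℓ (*-monoˡ-≤ (t ^ i * t ^ K) D≤J) ⟩
  ℓ * (J * (t ^ i * t ^ K))                  ≡⟨ cong (λ a → ℓ * (J * a)) (sym (split t)) ⟩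
  ℓ * (J * t ^ J)                            ∎
  where
  open ≤-Reasoning
  i = J ∸ K
  split : ∀ a → a ^ J ≡ a ^ i * a ^ K
  split a = trans (cong (a ^_) (sym (m∸n+n≡m K≤J))) (^-distribˡ-+-* a i K)
  e₁ : ∀ a b c d l → a * b * (c * d * l) ≡ l * (c * (a * (d * b)))
  e₁ = solve-∀
  e₂ : ∀ l c a b d → l * (c * (a * (b * d))) ≡ l * (c * b * (a * d))
  e₂ = solve-∀

-- Passing to e ≈ 1/ε costs a factor 2 ^ K, which the freedom in j absorbs.
hasCopies : ∀ {v n} (H : Graph v) (G : Graph n) D K j → D * 2 ^ K ≤ suc j → K ≤ suc j →
            ∀ {ε s t e} .{{_ : NonZero t}} → ε ≐ s / t → s ≤ t → e * s ≤ 2 * t →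
            ∃[ cs ] (AllPairs (Distinct {H = H} {G = G}) cs × n ^ v ≤ D * e ^ K * length cs) →
            HasCopies H G (((ℤ.+ 1) ℚ./ suc j) ℚ.* (ε ^ℚ suc j))
hasCopies {v} {n} H G D K j D≤J K≤J {ε} {s} {t} {e} ε≐ s≤t es≤2t (cs , distinct , enough) = cs , distinct ,
  scaled-≤⁺ {{m*n≢0 (suc j) (t ^ suc j) {{_}} {{m^n≢0 t (suc j)}}}}
    (≐-* (fraction 1 j) (≐-^ ε≐ (suc j))) (n ^ v) (length cs)
    (subst (λ a → a * n ^ v ≤ length cs * (suc j * t ^ suc j)) (sym (*-identityˡ (s ^ suc j)))
      (absorb-constants {s} {t} {e} {D} {K} {suc j} s≤t es≤2t D≤J K≤J enough))

rescale-≤ : ∀ {s t e m ℓ} .{{_ : NonZero s}} → t ≤ e * s → s * m ≤ ℓ * t → m ≤ e * ℓ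
rescale-≤ {s} {t} {e} {m} {ℓ} t≤es sm≤ℓt = *-cancelˡ-≤ s (begin
  s * m          ≤⟨ sm≤ℓt ⟩
  ℓ * t          ≤⟨ *-monoʳ-≤ ℓ t≤es ⟩
  ℓ * (e * s)    ≡⟨ e₁ ℓ e s ⟩
  s * (e * ℓ)    ∎)
  where
  open ≤-Reasoning
  e₁ : ∀ a b c → a * (b * c) ≡ c * (b * a)
  e₁ = solve-∀

-- `suc D` in place of `D` keeps the factor positive when `n = 0`, where a copy may be demanded
-- whatever `D` is.
manyCopies-list : ∀ {v n a} (H : Graph v) ((D , K , _) : ManyCopies H a) {e} → 0 ℕ.< e → (G : Graph n) →
                  MinDeg≥ G a → {cs : List (Copy H G)} → AllPairs (EdgeDisjoint {H = H} {G = G}) cs →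
                  n * n ≤ e * length cs →
                  ∃[ cs′ ] (AllPairs (Distinct {H = H} {G = G}) cs′ × n ^ v ≤ suc D * e ^ K * length cs′)
manyCopies-list {v} {zero} H (D , K , _) {e} 0<e G _ _ _ = weaken (manyCopies₀ H G)
  where
  weaken : ∃[ cs ] (AllPairs (Distinct {H = H} {G = G}) cs × 0 ^ v ≤ length cs) →
           ∃[ cs ] (AllPairs (Distinct {H = H} {G = G}) cs × 0 ^ v ≤ suc D * e ^ K * length cs)
  weaken (cs , distinct , len) = cs , distinct ,
    ≤-trans len (m≤n*m (length cs) (suc D * e ^ K) {{m*n≢0 (suc D) (e ^ K) {{_}} {{m^n≢0 e K {{>-nonZero 0<e}}}}}})
manyCopies-list {v} {n@(suc _)} H (D , K , bound) {e} 0<e G minDeg disjoint n²≤ = weaken (Homs.copies⇒list H G)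
  where
  open ≤-Reasoning
  weaken : ∃[ cs ] (AllPairs (Distinct {H = H} {G = G}) cs × length cs ≡ Homs.copies H G) →
           ∃[ cs ] (AllPairs (Distinct {H = H} {G = G}) cs × n ^ v ≤ suc D * e ^ K * length cs)
  weaken (cs , distinct , len) = cs , distinct , (begin
    n ^ v                              ≤⟨ bound 0<e G z<s minDeg disjoint n²≤ ⟩
    D * e ^ K * Homs.copies H G        ≤⟨ *-monoˡ-≤ (Homs.copies H G) (*-monoˡ-≤ (e ^ K) (n≤1+n D)) ⟩
    suc D * e ^ K * Homs.copies H G    ≡⟨ cong (suc D * e ^ K *_) (sym len) ⟩
    suc D * e ^ K * length cs          ∎)

ManyCopies⇒PolyRemAt : ∀ {v a} (H : Graph v) → ManyCopies H a → PolyRemAt H a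
-- 1/μ = `j + 1` must dominate both the coefficient, enlarged by `2 ^ K`, and the exponent; their
-- sum does.
ManyCopies⇒PolyRemAt {v} {a} H mc@(D , K , _) = suc D * 2 ^ K + K , λ ε 0<ε ε≤1 n G minDeg edgeDisjoint →
    polyRem ε≤1 G minDeg edgeDisjoint (positive-≐ ε 0<ε)
  where
  j = suc D * 2 ^ K + K
  polyRem : ∀ {ε n} → ε ℚ.≤ 1ℚ → (G : Graph n) → MinDeg≥ G a → HasEdgeDisjointCopies H G ε →
            ∃[ s ] ∃[ t ] (NonZero s × NonZero t × ε ≐ s / t) →
            HasCopies H G (((ℤ.+ 1) ℚ./ suc j) ℚ.* (ε ^ℚ suc j))
  polyRem {ε} {n} ε≤1 G minDeg (cs , disjoint , many) (s , t , s≢0 , t≢0 , ε≐) = conclude (ceiling s t {{s≢0}} s≤t)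
    where
    s≤t : s ≤ t
    s≤t = subst₂ _≤_ (*-identityʳ s) (*-identityˡ t)
      (scaled-≤⁻ ε≐ 1 1 (subst (ℚ._≤ 1ℚ) (sym (ℚ.*-identityʳ ε)) ε≤1))
    conclude : ∃[ e ] (0 ℕ.< e × t ≤ e * s × e * s ≤ 2 * t) →
               HasCopies H G (((ℤ.+ 1) ℚ./ suc j) ℚ.* (ε ^ℚ suc j))
    conclude (e , 0<e , t≤es , es≤2t) =
      hasCopies H G (suc D) K j (≤-trans (m≤m+n (suc D * 2 ^ K) K) (n≤1+n j)) (≤-trans (m≤n+m K (suc D * 2 ^ K)) (n≤1+n j))
        {e = e} {{t≢0}} ε≐ s≤t es≤2t
        (manyCopies-list {a = a} H mc {e} 0<e G minDeg disjoint
          (rescale-≤ {e = e} {ℓ = length cs} {{s≢0}} t≤es (scaled-≤⁻ ε≐ (n * n) (length cs) many)))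

theorem1p3 : ∀ {v} (H : Graph v) (b t : ℚ) → HomAt H b → b < t →
    Σ ℚ (λ a → (a < t) × PolyRemAt H a)
theorem1p3 H b t homAt b<t = between (ℚ.<-dense b<t)
  where
  between : ∃[ a ] (b < a × a < t) → Σ ℚ (λ a → (a < t) × PolyRemAt H a)
  between (a , b<a , a<t) = a , a<t , ManyCopies⇒PolyRemAt {a = a} H (manyCopies H {a} {b} homAt (degreeInherited {a} {b} b<a))
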